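{- Let $n \ge 4$ be an integer with $n \ne 6$, and let $\rho$ be an integer with $1 \le \rho \le n-1$. Then there exists a $(3n-1+\rho,4)$-packing with exactly $(n-1)\rho + D(\rho,4)$ blocks in which the largest partial parallel class has size $\rho$.
   Context: For integers $v \ge k \ge 2$, a $(v,k)$-packing is a pair $(X,\mathcal{B})$ where $X$ is a set of $v$ points and $\mathcal{B}$ is a set of $k$-subsets of $X$ (blocks) such that every pair of distinct points lies in at most one block. For integers $m \ge 0$, $D(m,k)$ denotes the maximum number of $k$-subsets of an $m$-set such that every pair of points lies in at most one of them (so $D(m,k)=0$ if $m<k$). A partial parallel class (PPC) is a set of pairwise disjoint blocks; its size is the number of blocks. "The largest PPC has size $\rho$" means the packing has a PPC of size $\rho$ but none of size $\rho+1$. -}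

module Defs where

import Data.Bool.Properties as Bool
open import Data.Fin using (Fin; zero; suc; combine)
open import Data.Fin.Properties using (all?; combine-injective; injective⇒≤)
  renaming (_≟_ to _≟ᶠ_)
open import Data.Fin.Subset using (Subset; Empty; _∩_; ∣_∣; inside; outside)
  renaming (_∈_ to _∈ˢ_)
open import Data.Fin.Subset.Properties using (anySubset?)
  renaming (_∈?_ to _∈ˢ?_)
open import Data.List using (List; []; _∷_; length; lookup)
open import Data.List.Membership.Propositional using (_∈_)
open import Data.List.Membership.Propositional.Properties using (∈-lookup)
open import Data.List.Relation.Unary.All as All using (All; []; _∷_)
open import Data.List.Relation.Unary.AllPairs using (AllPairs; []; _∷_; allPairs?)
open import Data.List.Relation.Unary.Unique.Propositional using (Unique)
open import Data.Nat using (ℕ; zero; suc; _≤_; _^_)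
open import Data.Nat.Properties using (_≟_; ≤-pred; ≤∧≢⇒<)
open import Data.Product using (∃; ∃-syntax; _×_; _,_; proj₁; proj₂)
open import Data.Vec using ([]; _∷_)
open import Data.Vec.Properties using (≡-dec)
open import Relation.Binary.Definitions using (DecidableEquality)
open import Relation.Binary.PropositionalEquality
  using (_≡_; _≢_; refl; sym; cong)
open import Relation.Nullary using (¬_; Dec; yes; no; contradiction)
open import Relation.Nullary.Decidable using (_×-dec_; _→-dec_; ¬?; map′)
open import Relation.Unary using (Decidable)

-- A finite set of blocks is a duplicate-free list of subsets of the point set
-- Fin v, so that its cardinality is the length of the list.
record IsPacking {v : ℕ} (k : ℕ) (blocks : List (Subset v)) : Set where
  field
    unique    : Unique blocks
    uniform   : All (λ B → ∣ B ∣ ≡ k) blocks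
    pair-≤1  : ∀ {x y : Fin v} {B C : Subset v} → x ≢ y →
                B ∈ blocks → C ∈ blocks →
                x ∈ˢ B → y ∈ˢ B → x ∈ˢ C → y ∈ˢ C → B ≡ C

record Packing (v k : ℕ) : Set where
  field
    2≤k       : 2 ≤ k
    k≤v       : k ≤ v
    blocks    : List (Subset v)
    isPacking : IsPacking k blocks

open Packing public using (blocks)

record IsPPC {v k : ℕ} (𝓟 : Packing v k) (class : List (Subset v)) : Set where
  field
    unique   : Unique class
    ⊆-blocks : All (_∈ blocks 𝓟) class
    disjoint : AllPairs (λ B C → Empty (B ∩ C)) class

HasPPC : ∀ {v k} → Packing v k → ℕ → Set
HasPPC 𝓟 s = ∃[ class ] IsPPC 𝓟 class × length class ≡ s

LargestPPC : ∀ {v k} → Packing v k → ℕ → Set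
LargestPPC 𝓟 ρ = HasPPC 𝓟 ρ × ¬ HasPPC 𝓟 (suc ρ)

-- Unlike Packing, this does not require 2 ≤ k ≤ m: for m < k only the empty
-- family qualifies.
PackingOfSize : (m k b : ℕ) → Set
PackingOfSize m k b = ∃[ 𝓑 ] IsPacking {m} k 𝓑 × length 𝓑 ≡ b

IsMaximum : (ℕ → Set) → ℕ → Set
IsMaximum P d = P d × (∀ b → P b → b ≤ d)

private
  _≟ˢ_ : ∀ {v} → DecidableEquality (Subset v)
  _≟ˢ_ = ≡-dec Bool._≟_

  isPacking? : ∀ {v} k → Decidable (IsPacking {v} k)
  isPacking? k 𝓑 = map′
    (λ (u , s , p) → record
      { unique  = u
      ; uniform = s
      ; pair-≤1 = λ {x} {y} x≢y B∈ C∈ xB yB xC yC →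
          All.lookup (All.lookup (p x y x≢y) B∈) C∈ ((xB , yB) , (xC , yC)) })
    (λ q → let open IsPacking q in unique , uniform , λ x y x≢y →
      All.tabulate λ B∈ → All.tabulate λ C∈ ((xB , yB) , (xC , yC)) →
        pair-≤1 x≢y B∈ C∈ xB yB xC yC)
    (allPairs? (λ B C → ¬? (B ≟ˢ C)) 𝓑
      ×-dec All.all? (λ B → ∣ B ∣ ≟ k) 𝓑
      ×-dec all? λ x → all? λ y → ¬? (x ≟ᶠ y) →-dec
        All.all? (λ B → All.all? (λ C →
          ((x ∈ˢ? B ×-dec y ∈ˢ? B) ×-dec (x ∈ˢ? C ×-dec y ∈ˢ? C))
            →-dec (B ≟ˢ C)) 𝓑) 𝓑)

  anyFamily? : ∀ {v} {P : List (Subset v) → Set} → Decidable P →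
               ∀ b → Dec (∃[ 𝓑 ] P 𝓑 × length 𝓑 ≡ b)
  anyFamily? P? zero = map′
    (λ p → [] , p , refl) (λ { ([] , p , _) → p }) (P? [])
  anyFamily? P? (suc b) = map′
    (λ { (B , 𝓑 , p , refl) → B ∷ 𝓑 , p , refl })
    (λ { (B ∷ 𝓑 , p , refl) → B , 𝓑 , p , refl })
    (anySubset? λ B → anyFamily? (λ 𝓑 → P? (B ∷ 𝓑)) b)

  encode : ∀ {v} → Subset v → Fin (2 ^ v)
  encode []            = zero
  encode (inside  ∷ p) = combine (suc (zero {0})) (encode p)
  encode (outside ∷ p) = combine (zero {1}) (encode p)

  encode-injective : ∀ {v} {p q : Subset v} → encode p ≡ encode q → p ≡ q
  encode-injective {p = []} {[]} _ = refl
  encode-injective {p = inside ∷ p} {inside ∷ q} eq =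
    cong (inside ∷_) (encode-injective (proj₂
      (combine-injective (suc (zero {0})) (encode p) (suc zero) (encode q) eq)))
  encode-injective {p = outside ∷ p} {outside ∷ q} eq =
    cong (outside ∷_) (encode-injective (proj₂
      (combine-injective (zero {1}) (encode p) zero (encode q) eq)))
  encode-injective {p = inside ∷ p} {outside ∷ q} eq
    with () ← proj₁ (combine-injective (suc (zero {0})) (encode p) zero (encode q) eq)
  encode-injective {p = outside ∷ p} {inside ∷ q} eq
    with () ← proj₁ (combine-injective (zero {1}) (encode p) (suc zero) (encode q) eq)

  lookup-injective : ∀ {A : Set} {xs : List A} → Unique xs →
                     ∀ {i j} → lookup xs i ≡ lookup xs j → i ≡ j
  lookup-injective (_ ∷ _)  {zero}  {zero}  _  = refl
  lookup-injective (x∉ ∷ _) {zero}  {suc j} eq =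
    contradiction eq (All.lookup x∉ (∈-lookup j))
  lookup-injective (x∉ ∷ _) {suc i} {zero}  eq =
    contradiction (sym eq) (All.lookup x∉ (∈-lookup i))
  lookup-injective (_ ∷ u)  {suc i} {suc j} eq = cong suc (lookup-injective u eq)

  size-bound : ∀ {m k} b → PackingOfSize m k b → b ≤ 2 ^ m
  size-bound _ (𝓑 , p , refl) =
    injective⇒≤ {f = λ i → encode (lookup 𝓑 i)}
      (λ eq → lookup-injective (IsPacking.unique p) (encode-injective eq))

  maximum : {P : ℕ → Set} → Decidable P → P 0 →
            ∀ N → (∀ b → P b → b ≤ N) → ∃ (IsMaximum P)
  maximum P? p₀ zero    bound = zero , p₀ , bound
  maximum P? p₀ (suc N) bound with P? (suc N)
  ... | yes p = suc N , p , bound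
  ... | no ¬p = maximum P? p₀ N λ b p →
    ≤-pred (≤∧≢⇒< (bound b p) λ { refl → ¬p p })

packingNumber : ∀ m k → ∃ (IsMaximum (PackingOfSize m k))
packingNumber m k = maximum (anyFamily? (isPacking? k))
  ([] , record { unique = [] ; uniform = [] ; pair-≤1 = λ _ () } , refl)
  (2 ^ m) size-bound

D : ℕ → ℕ → ℕ
D m k = proj₁ (packingNumber m k)

D-isMaximum : ∀ m k → IsMaximum (PackingOfSize m k) (D m k)
D-isMaximum m k = proj₂ (packingNumber m k)

-- Put m = n - 1. It suffices to find, on 3m + 2 points, m classes of m disjoint
-- triples such that no pair of points is covered twice, together with a
-- "rainbow": one triple from each class, the m of them pairwise disjoint. Join a
-- new point to all triples of each of the first ρ classes and put a maximum
-- packing on the ρ new points. The rainbow becomes a partial parallel class of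
-- size ρ, and none is larger because every block contains a new point.
--
-- If q is prime to 6, the triples A(x + e), B(2x + e), C(3x + e) over ℤ/q, with
-- class x and any fixed e as rainbow, solve m = q; dropping a class and a point
-- solves m = q - 1. This leaves m = q + 1 and m = q + 2 with q = 6r + 1 = 3s + 1.
-- There one breaks up some of the triples in each class, gaining one or two
-- triples by using 5 or 8 points at infinity, and adds new classes that consist
-- of triples inside A, B and C, of the form {3i, 3i + 1, 3i + 2} and
-- {i, i + s, i + 2s}. The second kind needs s > 2, so m = 3, 8, 9 remain; these
-- come from starters over ℤ/m found by computer.

module Submission where

open import Defs
open import Algebra.Bundles using (CommutativeRing)
import Algebra.Consequences.Propositional as Consequences
import Algebra.Solver.Ring
open import Algebra.Solver.Ring.AlmostCommutativeRing
  using (fromCommutativeRing; _-Raw-AlmostCommutative⟶_)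
open import Data.Bool using (true; false; if_then_else_)
open import Data.Fin as Fin using (Fin; zero; suc; toℕ; fromℕ<; inject≤; cast; _↑ˡ_; _↑ʳ_;
  splitAt; join; combine; remQuot; quotient; punchIn; punchOut)
open import Data.Fin.Patterns using (0F; 1F; 2F; 3F; 4F; 5F; 6F; 7F)
import Data.Fin.Properties as Fin
open import Data.Fin.Subset using (Subset; ⁅_⁆; _∪_; _∩_; ∣_∣; Empty)
  renaming (⊥ to ∅; _∈_ to _∈ˢ_; _∉_ to _∉ˢ_)
open import Data.Fin.Subset.Properties using (x∈⁅x⁆; x∈⁅y⁆⇒x≡y; ∣⁅x⁆∣≡1; ∣⊥∣≡0; ∉⊥;
  ∪-identityˡ; x∈p∪q⁻; x∈p∪q⁺; x∈p∩q⁺; x∈p∩q⁻; nonempty?; Empty-unique)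
open import Data.Integer as ℤ using (ℤ; +_)
import Data.Integer.DivMod as ℤ
open import Data.Integer.Divisibility.Signed as ℤ using (divides; ∣⇒∣ᵤ)
import Data.Integer.Properties as ℤ
import Data.Integer.Solver as ℤ
open import Data.List as List using (List; []; _∷_; length; lookup; map; allFin; cartesianProductWith)
open import Data.List.Membership.Propositional using (_∈_)
open import Data.List.Membership.Propositional.Properties
  using (∈-map⁻; ∈-++⁻; ∈-++⁺ˡ; ∈-cartesianProductWith⁺; ∈-cartesianProductWith⁻; ∈-allFin; ∈-lookup)
open import Data.List.Properties using (length-++; length-map; length-tabulate)
open import Data.List.Relation.Unary.All as All using (All; []; _∷_)
open import Data.List.Relation.Unary.AllPairs as AllPairs using (AllPairs; []; _∷_)
import Data.List.Relation.Unary.AllPairs.Properties as AllPairs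
import Data.List.Relation.Unary.Unique.Propositional.Properties as Unique
open import Data.Maybe as Maybe using (Maybe; just; nothing)
import Data.Maybe.Properties as Maybe
open import Data.Nat as ℕ using (ℕ; zero; suc; _≤_; _<_; z≤n; s≤s; z<s; s<s⁻¹; _/_; _%_; NonZero)
import Data.Nat.Divisibility as ℕ
open import Data.Nat.DivMod using (_divMod_; result)
import Data.Nat.Properties as ℕ
import Data.Nat.Solver as ℕ
open import Data.Product using (_×_; _,_; ∃-syntax; Σ-syntax; proj₁; proj₂; uncurry; swap)
import Data.Product.Properties as Product
open import Data.Sum as Sum using (_⊎_; inj₁; inj₂; [_,_]′)
import Data.Sum.Properties as Sum
open import Data.Unit using (⊤; tt)
open import Data.Vec as Vec using (Vec; []; _∷_; _++_)
open import Data.Vec.Properties using ([]=⇒lookup; lookup⇒[]=; lookup-++ˡ; lookup-++ʳ; ++-injectiveʳ)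
open import Function using (_∘_; id; const; case_of_)
open import Level using (0ℓ)
open import Relation.Binary.Definitions using (tri<; tri≈; tri>)
open import Relation.Binary.PropositionalEquality hiding ([_])
open import Relation.Nullary using (¬_; Dec; yes; no; does; contradiction)
open import Relation.Nullary.Decidable using (_×-dec_; _→-dec_; ¬?; True; toWitness; dec⇒maybe)

-- From rainbow designs to packings

∣⁅x⁆∪p∣≡1+∣p∣ : ∀ {n} {x : Fin n} {p} → x ∉ˢ p → ∣ ⁅ x ⁆ ∪ p ∣ ≡ suc ∣ p ∣
∣⁅x⁆∪p∣≡1+∣p∣ {x = zero}  {true  ∷ p} x∉p = contradiction Vec.here x∉p
∣⁅x⁆∪p∣≡1+∣p∣ {x = zero}  {false ∷ p} x∉p = cong (suc ∘ ∣_∣) (∪-identityˡ p)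
∣⁅x⁆∪p∣≡1+∣p∣ {x = suc x} {true  ∷ p} x∉p = cong suc (∣⁅x⁆∪p∣≡1+∣p∣ (x∉p ∘ Vec.there))
∣⁅x⁆∪p∣≡1+∣p∣ {x = suc x} {false ∷ p} x∉p = ∣⁅x⁆∪p∣≡1+∣p∣ (x∉p ∘ Vec.there)

∣p++q∣≡∣p∣+∣q∣ : ∀ {m n} (p : Subset m) (q : Subset n) → ∣ p ++ q ∣ ≡ ∣ p ∣ ℕ.+ ∣ q ∣
∣p++q∣≡∣p∣+∣q∣ []          q = refl
∣p++q∣≡∣p∣+∣q∣ (true  ∷ p) q = cong suc (∣p++q∣≡∣p∣+∣q∣ p q)
∣p++q∣≡∣p∣+∣q∣ (false ∷ p) q = ∣p++q∣≡∣p∣+∣q∣ p q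

module _ {m n} (p : Subset m) (q : Subset n) where

  ↑ˡ∈++⇒∈ : ∀ {x} → (x ↑ˡ n) ∈ˢ (p ++ q) → x ∈ˢ p
  ↑ˡ∈++⇒∈ {x} x∈ = lookup⇒[]= x p (trans (sym (lookup-++ˡ p q x)) ([]=⇒lookup x∈))

  ↑ʳ∈++⇒∈ : ∀ {y} → (m ↑ʳ y) ∈ˢ (p ++ q) → y ∈ˢ q
  ↑ʳ∈++⇒∈ {y} y∈ = lookup⇒[]= y q (trans (sym (lookup-++ʳ p q y)) ([]=⇒lookup y∈))

  ∈⇒↑ˡ∈++ : ∀ {x} → x ∈ˢ p → (x ↑ˡ n) ∈ˢ (p ++ q)
  ∈⇒↑ˡ∈++ {x} x∈ = lookup⇒[]= (x ↑ˡ n) (p ++ q) (trans (lookup-++ˡ p q x) ([]=⇒lookup x∈))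

  ∈⇒↑ʳ∈++ : ∀ {y} → y ∈ˢ q → (m ↑ʳ y) ∈ˢ (p ++ q)
  ∈⇒↑ʳ∈++ {y} y∈ = lookup⇒[]= (m ↑ʳ y) (p ++ q) (trans (lookup-++ʳ p q y) ([]=⇒lookup y∈))

data Split (m n : ℕ) : Fin (m ℕ.+ n) → Set where
  left  : ∀ x → Split m n (x ↑ˡ n)
  right : ∀ y → Split m n (m ↑ʳ y)

split : ∀ m {n} i → Split m n i
split m i with splitAt m i in eq
... | inj₁ x = subst (Split m _) (Fin.splitAt⁻¹-↑ˡ eq) (left x)
... | inj₂ y = subst (Split m _) (Fin.splitAt⁻¹-↑ʳ eq) (right y)

length-cartesianProductWith : ∀ {A B C : Set} (f : A → B → C) xs ys →
  length (cartesianProductWith f xs ys) ≡ length xs ℕ.* length ys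
length-cartesianProductWith f []       ys = refl
length-cartesianProductWith f (x ∷ xs) ys = trans (length-++ (map (f x) ys))
  (cong₂ ℕ._+_ (length-map (f x) ys) (length-cartesianProductWith f xs ys))

length-allFin : ∀ n → length (allFin n) ≡ n
length-allFin n = length-tabulate id

lookup-AllPairs : ∀ {A : Set} {R : A → A → Set} {xs : List A} → AllPairs R xs →
  ∀ {i j} → i Fin.< j → R (lookup xs i) (lookup xs j)
lookup-AllPairs (Rx ∷ _)  {zero}  {suc j} _   = All.lookup Rx (∈-lookup j)
lookup-AllPairs (_ ∷ Rxs) {suc i} {suc j} i<j = lookup-AllPairs Rxs (s<s⁻¹ i<j)

⟦_⟧ : ∀ {n} → (Fin 3 → Fin n) → Subset n
⟦ f ⟧ = ⁅ f 0F ⁆ ∪ ⁅ f 1F ⁆ ∪ ⁅ f 2F ⁆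

∈⟦⟧⁻ : ∀ {n} (f : Fin 3 → Fin n) {x} → x ∈ˢ ⟦ f ⟧ → ∃[ a ] f a ≡ x
∈⟦⟧⁻ f x∈ with x∈p∪q⁻ ⁅ f 0F ⁆ _ x∈
... | inj₁ x∈₀ = 0F , sym (x∈⁅y⁆⇒x≡y (f 0F) x∈₀)
... | inj₂ x∈₁₂ with x∈p∪q⁻ ⁅ f 1F ⁆ _ x∈₁₂
...   | inj₁ x∈₁ = 1F , sym (x∈⁅y⁆⇒x≡y (f 1F) x∈₁)
...   | inj₂ x∈₂ = 2F , sym (x∈⁅y⁆⇒x≡y (f 2F) x∈₂)

∈⟦⟧⁺ : ∀ {n} (f : Fin 3 → Fin n) a → f a ∈ˢ ⟦ f ⟧
∈⟦⟧⁺ f 0F = x∈p∪q⁺ (inj₁ (x∈⁅x⁆ _))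
∈⟦⟧⁺ f 1F = x∈p∪q⁺ {p = ⁅ f 0F ⁆} (inj₂ (x∈p∪q⁺ (inj₁ (x∈⁅x⁆ _))))
∈⟦⟧⁺ f 2F = x∈p∪q⁺ {p = ⁅ f 0F ⁆} (inj₂ (x∈p∪q⁺ {p = ⁅ f 1F ⁆} (inj₂ (x∈⁅x⁆ _))))

∣⟦⟧∣≡3 : ∀ {n} (f : Fin 3 → Fin n) → (∀ {a b} → f a ≡ f b → a ≡ b) → ∣ ⟦ f ⟧ ∣ ≡ 3
∣⟦⟧∣≡3 f inj = trans
  (∣⁅x⁆∪p∣≡1+∣p∣ λ f0∈ → [ 0≢1 ∘ inj ∘ x∈⁅y⁆⇒x≡y _ , 0≢2 ∘ inj ∘ x∈⁅y⁆⇒x≡y _ ]′ (x∈p∪q⁻ ⁅ f 1F ⁆ _ f0∈))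
  (cong suc (trans (∣⁅x⁆∪p∣≡1+∣p∣ (1≢2 ∘ inj ∘ x∈⁅y⁆⇒x≡y _)) (cong suc (∣⁅x⁆∣≡1 (f 2F)))))
  where
  0≢1 : 0F ≢ 1F
  0≢1 ()
  0≢2 : 0F ≢ 2F
  0≢2 ()
  1≢2 : 1F ≢ 2F
  1≢2 ()

-- J k indexes the triples of the k-th class; each class is a partial parallel
-- class, and no two classes have a pair of points in common.
record Design (K : Set) (J : K → Set) (P : Set) : Set where
  field
    pt         : ∀ k → J k → Fin 3 → P
    disjoint   : ∀ {k j j′ a a′} → pt k j a ≡ pt k j′ a′ → j ≡ j′ × a ≡ a′
    pair→class : ∀ {k k′ j j′ a b a′ b′} → a ≢ b →
                 pt k j a ≡ pt k′ j′ a′ → pt k j b ≡ pt k′ j′ b′ → k ≡ k′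

Rainbow : ∀ {K J P} → Design K J P → Set
Rainbow {K} {J} D = Σ[ T ∈ (∀ k → J k) ]
  (∀ {k k′ a a′} → pt k (T k) a ≡ pt k′ (T k′) a′ → k ≡ k′)
  where open Design D

RainbowDesign : ℕ → ℕ → Set
RainbowDesign m u = Σ[ 𝒟 ∈ Design (Fin m) (λ _ → Fin m) (Fin u) ] Rainbow 𝒟

-- The packing on the old and the new points

module _ {m u : ℕ} (𝒟 : Design (Fin m) (λ _ → Fin m) (Fin u)) (𝓡 : Rainbow 𝒟)
         {ρ : ℕ} (ρ≤m : ρ ≤ m) where

  open Design 𝒟

  private
    T : Fin m → Fin m
    T = proj₁ 𝓡

    tri : Fin ρ → Fin m → Fin 3 → Fin u
    tri i = pt (inject≤ i ρ≤m)

    block : Fin ρ → Fin m → Subset (u ℕ.+ ρ)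
    block i j = ⟦ tri i j ⟧ ++ ⁅ i ⁆

    lift : Subset ρ → Subset (u ℕ.+ ρ)
    lift = ∅ {u} ++_

    𝓑 : List (Subset ρ)
    𝓑 = proj₁ (proj₁ (D-isMaximum ρ 4))

    𝓑-packing : IsPacking 4 𝓑
    𝓑-packing = proj₁ (proj₂ (proj₁ (D-isMaximum ρ 4)))

    module 𝓑 = IsPacking 𝓑-packing

    long : List (Subset (u ℕ.+ ρ))
    long = cartesianProductWith block (allFin ρ) (allFin m)

    all : List (Subset (u ℕ.+ ρ))
    all = long List.++ map lift 𝓑

    -- A view of membership in `all`: matching on it exposes the class and triple of a long block,
    -- or the short block that was lifted.
    data IsBlock : Subset (u ℕ.+ ρ) → Set where
      isLong  : ∀ i j → IsBlock (block i j)
      isShort : ∀ {B} → B ∈ 𝓑 → IsBlock (lift B)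

    isBlock : ∀ {B} → B ∈ all → IsBlock B
    isBlock B∈ with ∈-++⁻ long B∈
    ... | inj₁ B∈ˡ
      with i , j , _ , _ , refl ← ∈-cartesianProductWith⁻ block (allFin ρ) (allFin m) B∈ˡ = isLong i j
    ... | inj₂ B∈ʳ with B , B∈𝓑 , refl ← ∈-map⁻ lift B∈ʳ = isShort B∈𝓑

    ∈⁅⁆ : ∀ {i j y} → (u ↑ʳ y) ∈ˢ block i j → y ≡ i
    ∈⁅⁆ {i} {j} y∈ = x∈⁅y⁆⇒x≡y i (↑ʳ∈++⇒∈ ⟦ tri i j ⟧ ⁅ i ⁆ y∈)

    ∈tri : ∀ {i j x} → (x ↑ˡ ρ) ∈ˢ block i j → ∃[ a ] tri i j a ≡ x
    ∈tri {i} {j} x∈ = ∈⟦⟧⁻ (tri i j) (↑ˡ∈++⇒∈ ⟦ tri i j ⟧ ⁅ i ⁆ x∈)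

    tri∈block : ∀ i j → (tri i j 0F ↑ˡ ρ) ∈ˢ block i j
    tri∈block i j = ∈⇒↑ˡ∈++ ⟦ tri i j ⟧ ⁅ i ⁆ (∈⟦⟧⁺ (tri i j) 0F)

    ∉lift : ∀ {B x} → ¬ (x ↑ˡ ρ) ∈ˢ lift B
    ∉lift {B} x∈ = ∉⊥ (↑ˡ∈++⇒∈ (∅ {u}) B x∈)

    ∈lift : ∀ {B y} → (u ↑ʳ y) ∈ˢ lift B → y ∈ˢ B
    ∈lift {B} = ↑ʳ∈++⇒∈ (∅ {u}) B

    class-injective : ∀ {i i′ j j′ a b a′ b′} → a ≢ b →
      tri i j a ≡ tri i′ j′ a′ → tri i j b ≡ tri i′ j′ b′ → i ≡ i′
    class-injective a≢b p q = Fin.inject≤-injective ρ≤m ρ≤m _ _ (pair→class a≢b p q)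

    same-triple : ∀ {i j j′ a a′} → tri i j a ≡ tri i j′ a′ → block i j ≡ block i j′
    same-triple p = cong (block _) (proj₁ (disjoint p))

    -- Two old points fix the class by `pair→class`; an old and a new point fix it by the new one.
    -- In both cases an old point then fixes the triple, as a class is disjoint. Two new points lie
    -- together only in lifted blocks, which form a packing already.
    pair-≤1 : ∀ {x y B C} → x ≢ y → IsBlock B → IsBlock C →
              x ∈ˢ B → y ∈ˢ B → x ∈ˢ C → y ∈ˢ C → B ≡ C
    pair-≤1 {x} {y} x≢y B? C? xB yB xC yC with split u x | split u y | B? | C?
    ... | left _ | left _ | isLong i j | isLong i′ j′
      with a , refl ← ∈tri xB | b , refl ← ∈tri yB | _ , p ← ∈tri xC | _ , q ← ∈tri yC
      with refl ← class-injective {i} {i′} (λ { refl → x≢y refl }) (sym p) (sym q) = same-triple (sym p)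
    ... | left _ | right _ | isLong i j | isLong i′ j′
      with _ , refl ← ∈tri xB | _ , p ← ∈tri xC | refl ← ∈⁅⁆ {i} {j} yB | refl ← ∈⁅⁆ {i′} {j′} yC =
      same-triple (sym p)
    ... | right _ | left _ | isLong i j | isLong i′ j′
      with _ , refl ← ∈tri yB | _ , p ← ∈tri yC | refl ← ∈⁅⁆ {i} {j} xB | refl ← ∈⁅⁆ {i′} {j′} xC =
      same-triple (sym p)
    ... | right _ | right _ | isLong i j | _ =
      contradiction (cong (u ↑ʳ_) (trans (∈⁅⁆ {i} {j} xB) (sym (∈⁅⁆ {i} {j} yB)))) x≢y
    ... | right _ | right _ | isShort _ | isLong i j =
      contradiction (cong (u ↑ʳ_) (trans (∈⁅⁆ {i} {j} xC) (sym (∈⁅⁆ {i} {j} yC)))) x≢y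
    ... | right _ | right _ | isShort B∈ | isShort C∈ =
      cong lift (𝓑.pair-≤1 (λ { refl → x≢y refl }) B∈ C∈ (∈lift xB) (∈lift yB) (∈lift xC) (∈lift yC))
    ... | left _ | _ | isShort _ | _ = contradiction xB ∉lift
    ... | left _ | _ | _ | isShort _ = contradiction xC ∉lift
    ... | _ | left _ | isShort _ | _ = contradiction yB ∉lift
    ... | _ | left _ | _ | isShort _ = contradiction yC ∉lift

    block-injective : ∀ {i i′ j j′} → block i j ≡ block i′ j′ → i ≡ i′ × j ≡ j′
    block-injective {i} {i′} {j} {j′} eq
      with refl ← x∈⁅y⁆⇒x≡y i′ (subst (i ∈ˢ_) (++-injectiveʳ ⟦ tri i j ⟧ ⟦ tri i′ j′ ⟧ eq) (x∈⁅x⁆ i))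
      with _ , p ← ∈⟦⟧⁻ (tri i j′) (↑ˡ∈++⇒∈ ⟦ tri i j′ ⟧ ⁅ i ⁆
             (subst ((tri i j 0F ↑ˡ ρ) ∈ˢ_) eq (tri∈block i j)))
      = refl , sym (proj₁ (disjoint p))

    -- This bounds partial parallel classes: disjoint blocks contain different new points, of which
    -- there are only `ρ`. A short block has four points, so it is not empty.
    meets-new : ∀ {B} → IsBlock B → ∃[ y ] (u ↑ʳ y) ∈ˢ B
    meets-new (isLong i j) = i , ∈⇒↑ʳ∈++ ⟦ tri i j ⟧ ⁅ i ⁆ (x∈⁅x⁆ i)
    meets-new (isShort {B} B∈) with nonempty? B
    ... | yes (y , y∈) = y , ∈⇒↑ʳ∈++ (∅ {u}) B y∈
    ... | no empty = contradiction
      (trans (sym (All.lookup 𝓑.uniform B∈)) (trans (cong ∣_∣ (Empty-unique empty)) (∣⊥∣≡0 ρ))) λ()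

    uniform : ∀ {B} → IsBlock B → ∣ B ∣ ≡ 4
    uniform (isLong i j) = trans (∣p++q∣≡∣p∣+∣q∣ ⟦ tri i j ⟧ ⁅ i ⁆)
      (cong₂ ℕ._+_ (∣⟦⟧∣≡3 (tri i j) (proj₂ ∘ disjoint)) (∣⁅x⁆∣≡1 i))
    uniform (isShort {B} B∈) = trans (∣p++q∣≡∣p∣+∣q∣ (∅ {u}) B)
      (cong₂ ℕ._+_ (∣⊥∣≡0 u) (All.lookup 𝓑.uniform B∈))

    isPacking : IsPacking 4 all
    isPacking = record
      { unique  = Unique.++⁺
          (Unique.cartesianProductWith⁺ block block-injective (Unique.allFin⁺ ρ) (Unique.allFin⁺ m))
          (Unique.map⁺ (++-injectiveʳ (∅ {u}) ∅) 𝓑.unique)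
          λ (B∈ˡ , B∈ʳ) → long∩short B∈ˡ B∈ʳ
      ; uniform = All.tabulate (uniform ∘ isBlock)
      ; pair-≤1 = λ x≢y B∈ C∈ → pair-≤1 x≢y (isBlock B∈) (isBlock C∈)
      }
      where
      long∩short : ∀ {B} → B ∈ long → B ∈ map lift 𝓑 → _
      long∩short B∈ˡ B∈ʳ
        with i , j , _ , _ , eq ← ∈-cartesianProductWith⁻ block (allFin ρ) (allFin m) B∈ˡ
        with B , _ , refl ← ∈-map⁻ lift B∈ʳ
        = ∉lift {B} (subst ((tri i j 0F ↑ˡ ρ) ∈ˢ_) (sym eq) (tri∈block i j))

  packing : 4 ≤ u ℕ.+ ρ → Packing (u ℕ.+ ρ) 4
  packing 4≤ = record { 2≤k = s≤s (s≤s z≤n) ; k≤v = 4≤ ; blocks = all ; isPacking = isPacking }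

  length-packing : (4≤ : 4 ≤ u ℕ.+ ρ) → length (blocks (packing 4≤)) ≡ m ℕ.* ρ ℕ.+ D ρ 4
  length-packing _ = begin
    length all
      ≡⟨ length-++ long ⟩
    length long ℕ.+ length (map lift 𝓑)
      ≡⟨ cong₂ ℕ._+_ (length-cartesianProductWith block (allFin ρ) (allFin m)) (length-map lift 𝓑) ⟩
    length (allFin ρ) ℕ.* length (allFin m) ℕ.+ length 𝓑
      ≡⟨ cong₂ ℕ._+_ (cong₂ ℕ._*_ (length-allFin ρ) (length-allFin m))
                     (proj₂ (proj₂ (proj₁ (D-isMaximum ρ 4)))) ⟩
    ρ ℕ.* m ℕ.+ D ρ 4
      ≡⟨ cong (ℕ._+ D ρ 4) (ℕ.*-comm ρ m) ⟩
    m ℕ.* ρ ℕ.+ D ρ 4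
      ∎
    where open ≡-Reasoning

  largestPPC : (4≤ : 4 ≤ u ℕ.+ ρ) → LargestPPC (packing 4≤) ρ
  largestPPC 4≤ = (rainbow , ppc , trans (length-map _ (allFin ρ)) (length-allFin ρ)) , too-long
    where
    t : Fin ρ → Subset (u ℕ.+ ρ)
    t i = block i (T (inject≤ i ρ≤m))

    rainbow : List (Subset (u ℕ.+ ρ))
    rainbow = map t (allFin ρ)

    t-disjoint : ∀ {i i′} → i ≢ i′ → Empty (t i ∩ t i′)
    t-disjoint {i} {i′} i≢i′ (z , z∈) with x∈p∩q⁻ (t i) (t i′) z∈
    ... | zB , zC with split u z
    ...   | right _ = i≢i′ (trans (sym (∈⁅⁆ {i} {T (inject≤ i ρ≤m)} zB)) (∈⁅⁆ {i′} {T (inject≤ i′ ρ≤m)} zC))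
    ...   | left _ with _ , refl ← ∈tri zB | _ , p ← ∈tri zC =
      i≢i′ (Fin.inject≤-injective ρ≤m ρ≤m i i′ (proj₂ 𝓡 (sym p)))

    ppc : IsPPC (packing 4≤) rainbow
    ppc = record
      { unique   = Unique.map⁺ (proj₁ ∘ block-injective) (Unique.allFin⁺ ρ)
      ; ⊆-blocks = All.tabulate λ B∈ → t∈all (∈-map⁻ t B∈)
      ; disjoint = AllPairs.map⁺ (AllPairs.map t-disjoint (Unique.allFin⁺ ρ))
      }
      where
      t∈all : ∀ {B} → ∃[ i ] (i ∈ allFin ρ × B ≡ t i) → B ∈ all
      t∈all (i , i∈ , refl) = ∈-++⁺ˡ (∈-cartesianProductWith⁺ block i∈ (∈-allFin _))

    too-long : ¬ HasPPC (packing 4≤) (suc ρ)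
    too-long (𝓒 , 𝓒-ppc , len) =
      let i , j , i<j , eq = Fin.pigeonhole (ℕ.≤-reflexive (sym len)) (proj₁ ∘ hit)
      in lookup-AllPairs (IsPPC.disjoint 𝓒-ppc) i<j
           (_ , x∈p∩q⁺ (proj₂ (hit i) , subst (λ y → (u ↑ʳ y) ∈ˢ lookup 𝓒 j) (sym eq) (proj₂ (hit j))))
      where
      hit : ∀ i → ∃[ y ] (u ↑ʳ y) ∈ˢ lookup 𝓒 i
      hit i = meets-new (isBlock (All.lookup (IsPPC.⊆-blocks 𝓒-ppc) (∈-lookup i)))

-- Designs over ℤ/q

-- The design axioms become computations with inverses: `locate` recovers triple and position from a
-- class and a point, `colour` recovers the class from two points of one triple. Both may be
-- arbitrary elsewhere.
certified : ∀ {K : Set} {J : K → Set} {P : Set} (pt : ∀ k → J k → Fin 3 → P)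
  (locate : ∀ k → P → J k × Fin 3) → (∀ k j a → locate k (pt k j a) ≡ (j , a)) →
  (colour : P → P → K) → (∀ k j {a b} → a ≢ b → colour (pt k j a) (pt k j b) ≡ k) → Design K J P
certified {K} {J} pt locate located colour coloured = record
  { pt         = pt
  ; disjoint   = recover
  ; pair→class = λ {k} {k′} {j} {j′} a≢b p q → trans (sym (coloured k j a≢b)) (trans (cong₂ colour p q)
      -- If the second pair of positions coincided, both vertices of the first triple would be the
      -- same point.
      (coloured k′ j′ λ { refl → a≢b (proj₂ (recover (trans p (sym q)))) }))
  }
  where
  recover : ∀ {k : K} {j j′ : J k} {a a′} → pt k j a ≡ pt k j′ a′ → j ≡ j′ × a ≡ a′
  recover {k} {j} {j′} {a} {a′} eq = Product.,-injective
    (trans (sym (located k j a)) (trans (cong (locate k) eq) (located k j′ a′)))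

-- Restriction of a design

module _ {K J P} (𝒟 : Design K J P) {K′ : Set} {J′ : K′ → Set} {P′ : Set} where

  open Design 𝒟

  -- The new points are mapped back to the old ones by `point`, which only has to be right on
  -- vertices of the chosen triples. So the new point set may contain points on no triple.
  record Restriction : Set where
    field
      pt′         : ∀ k → J′ k → Fin 3 → P′
      class       : K′ → K
      triple      : ∀ k → J′ k → J (class k)
      point       : P′ → P
      class-inj   : ∀ {k l} → class k ≡ class l → k ≡ l
      triple-inj  : ∀ k {i j} → triple k i ≡ triple k j → i ≡ j
      point-pt′   : ∀ k j a → point (pt′ k j a) ≡ pt (class k) (triple k j) a

  module _ (R : Restriction) where
    open Restriction R

    private
      via-point : ∀ {k j a k′ j′ a′} → pt′ k j a ≡ pt′ k′ j′ a′ →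
                  pt (class k) (triple k j) a ≡ pt (class k′) (triple k′ j′) a′
      via-point eq = trans (sym (point-pt′ _ _ _)) (trans (cong point eq) (point-pt′ _ _ _))

    restrict : Design K′ J′ P′
    restrict = record
      { pt         = pt′
      ; disjoint   = λ eq → triple-inj _ (proj₁ (disjoint (via-point eq))) , proj₂ (disjoint (via-point eq))
      ; pair→class = λ a≢b p q → class-inj (pair→class a≢b (via-point p) (via-point q))
      }

    restrict-rainbow : (T : ∀ k → J k) (T′ : ∀ k → J′ k) → (∀ k → triple k (T′ k) ≡ T (class k)) →
      (∀ {k k′ a a′} → pt (class k) (T (class k)) a ≡ pt (class k′) (T (class k′)) a′ → class k ≡ class k′) →
      Rainbow restrict
    restrict-rainbow T T′ T≡ rainbow = T′ , λ {k} {k′} {a} {a′} eq → class-inj (rainbow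
      (subst₂ (λ i j → pt (class k) i a ≡ pt (class k′) j a′) (T≡ k) (T≡ k′) (via-point eq)))

-- The point (l , p) of Fin 3 × ℤ/m is coded as l * m + p, and the codes 3m and
-- 3m + 1 are fixed by the action of ℤ/m. Class i is the translate of base by i, and
-- the rainbow is the orbit of the first triple of base.
module Cyclic (m : ℕ) .{{_ : NonZero m}} (base : Vec (Vec ℕ 3) m) where

  u : ℕ
  u = 3 ℕ.* suc m ℕ.∸ 1

  translate : ℕ → ℕ → ℕ
  translate i c with c / m
  ... | 3 = c
  ... | l = l ℕ.* m ℕ.+ (c ℕ.+ i) % m

  code : Fin m → Fin m → Fin 3 → ℕ
  code i j a = translate (toℕ i) (Vec.lookup (Vec.lookup base j) a)

  bounded? : Dec (∀ i j a → code i j a < u)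
  bounded? = Fin.all? λ i → Fin.all? λ j → Fin.all? λ a → code i j a ℕ.<? u

  disjoint? : Dec (∀ i j a j′ a′ → code i j a ≡ code i j′ a′ → j ≡ j′ × a ≡ a′)
  disjoint? = Fin.all? λ i → Fin.all? λ j → Fin.all? λ a → Fin.all? λ j′ → Fin.all? λ a′ →
    (code i j a ℕ.≟ code i j′ a′) →-dec (j Fin.≟ j′ ×-dec a Fin.≟ a′)

  -- The second positions `b` and `b′` are quantified after the first equation, so that the search
  -- visits them only when two first vertices agree.
  pair→class? : Dec (∀ i j i′ j′ a a′ → code i j a ≡ code i′ j′ a′ →
                     ∀ b b′ → code i j b ≡ code i′ j′ b′ → a ≢ b → i ≡ i′)
  pair→class? = Fin.all? λ i → Fin.all? λ j → Fin.all? λ i′ → Fin.all? λ j′ → Fin.all? λ a → Fin.all? λ a′ →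
    (code i j a ℕ.≟ code i′ j′ a′) →-dec Fin.all? λ b → Fin.all? λ b′ →
    (code i j b ℕ.≟ code i′ j′ b′) →-dec (¬? (a Fin.≟ b) →-dec i Fin.≟ i′)

  transversal? : Dec (∀ i i′ j a a′ → toℕ j ≡ 0 → code i j a ≡ code i′ j a′ → i ≡ i′)
  transversal? = Fin.all? λ i → Fin.all? λ i′ → Fin.all? λ j → Fin.all? λ a → Fin.all? λ a′ →
    (toℕ j ℕ.≟ 0) →-dec (code i j a ℕ.≟ code i′ j a′) →-dec (i Fin.≟ i′)

  module _ (bounded : True bounded?) (disjoint : True disjoint?)
           (pair→class : True pair→class?) (transversal : True transversal?) (0<m : 0 < m) where

    private
      pt : Fin m → Fin m → Fin 3 → Fin u
      pt i j a = fromℕ< (toWitness bounded i j a)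

      pt≡⇒code≡ : ∀ {i j a i′ j′ a′} → pt i j a ≡ pt i′ j′ a′ → code i j a ≡ code i′ j′ a′
      pt≡⇒code≡ {i} {j} {a} {i′} {j′} {a′} eq = trans (sym (Fin.toℕ-fromℕ< (toWitness bounded i j a)))
        (trans (cong toℕ eq) (Fin.toℕ-fromℕ< (toWitness bounded i′ j′ a′)))

    cyclic : RainbowDesign m u
    cyclic = record
      { pt         = pt
      ; disjoint   = λ {k} {j} {j′} {a} {a′} eq → toWitness disjoint k j a j′ a′ (pt≡⇒code≡ eq)
      ; pair→class = λ {k} {k′} {j} {j′} {a} {b} {a′} {b′} a≢b p q →
          toWitness pair→class k j k′ j′ a a′ (pt≡⇒code≡ p) b b′ (pt≡⇒code≡ q) a≢b
      } , const (fromℕ< 0<m) , λ {k} {k′} {a} {a′} eq →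
        toWitness transversal k k′ (fromℕ< 0<m) a a′ (Fin.toℕ-fromℕ< 0<m) (pt≡⇒code≡ eq)

-- Starters for the small orders

design₃ : RainbowDesign 3 11
design₃ = Cyclic.cyclic 3
  ((0 ∷ 3 ∷ 6 ∷ []) ∷ (1 ∷ 8 ∷ 9 ∷ []) ∷ (2 ∷ 4 ∷ 10 ∷ []) ∷ []) _ _ _ _ z<s

design₈ : RainbowDesign 8 26
design₈ = Cyclic.cyclic 8
  ((0 ∷ 8 ∷ 16 ∷ []) ∷ (2 ∷ 19 ∷ 24 ∷ []) ∷ (1 ∷ 11 ∷ 22 ∷ []) ∷ (13 ∷ 18 ∷ 20 ∷ []) ∷
   (3 ∷ 15 ∷ 17 ∷ []) ∷ (9 ∷ 21 ∷ 25 ∷ []) ∷ (5 ∷ 14 ∷ 23 ∷ []) ∷ (4 ∷ 7 ∷ 10 ∷ []) ∷ []) _ _ _ _ z<s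

design₉ : RainbowDesign 9 29
design₉ = Cyclic.cyclic 9
  ((0 ∷ 9 ∷ 18 ∷ []) ∷ (6 ∷ 23 ∷ 27 ∷ []) ∷ (11 ∷ 25 ∷ 28 ∷ []) ∷ (7 ∷ 15 ∷ 19 ∷ []) ∷
   (10 ∷ 21 ∷ 22 ∷ []) ∷ (1 ∷ 20 ∷ 26 ∷ []) ∷ (16 ∷ 17 ∷ 24 ∷ []) ∷ (3 ∷ 8 ∷ 13 ∷ []) ∷
   (2 ∷ 4 ∷ 5 ∷ []) ∷ []) _ _ _ _ z<s

-- The ring of residues modulo q

module ℤmod (n : ℕ) where

  q : ℕ
  q = suc n

  Z : Set
  Z = Fin q

  ι : Z → ℤ
  ι x = + toℕ x

  [_] : ℤ → Z
  [ a ] = fromℕ< (ℤ.n%ℕd<d a q)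

  infix 4 _~_
  record _~_ (a b : ℤ) : Set where
    constructor mk~
    field div : + q ℤ.∣ a ℤ.- b

  open _~_

  ~-trans : ∀ {a b c} → a ~ b → b ~ c → a ~ c
  ~-trans {a} {b} {c} (mk~ a~b) (mk~ b~c) = mk~ (subst (+ q ℤ.∣_)
    (solve 3 (λ a b c → (a :- b) :+ (b :- c) := a :- c) refl a b c) (ℤ.∣m∣n⇒∣m+n a~b b~c))
    where open ℤ.+-*-Solver

  ~-sym : ∀ {a b} → a ~ b → b ~ a
  ~-sym {a} {b} (mk~ a~b) = mk~ (subst (+ q ℤ.∣_)
    (solve 2 (λ a b → :- (a :- b) := b :- a) refl a b) (ℤ.∣m⇒∣-m a~b))
    where open ℤ.+-*-Solver

  ι[_] : ∀ a → a ~ ι [ a ]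
  ι[ a ] = mk~ (divides (a ℤ./ℕ q) (begin
    a ℤ.- ι [ a ]                      ≡⟨ cong (λ r → a ℤ.- + r) (Fin.toℕ-fromℕ< (ℤ.n%ℕd<d a q)) ⟩
    a ℤ.- + r                          ≡⟨ cong (ℤ._- + r) (ℤ.a≡a%ℕn+[a/ℕn]*n a q) ⟩
    + r ℤ.+ a ℤ./ℕ q ℤ.* + q ℤ.- + r   ≡⟨ solve 2 (λ r k → r :+ k :- r := k) refl (+ r) _ ⟩
    a ℤ./ℕ q ℤ.* + q                   ∎))
    where
    open ≡-Reasoning
    open ℤ.+-*-Solver
    r = a ℤ.%ℕ q

  -- Two representatives differ by less than `q` in absolute value, so a difference divisible by `q`
  -- is zero.
  ι-injective : ∀ {x y} → ι x ~ ι y → x ≡ y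
  ι-injective {x} {y} (mk~ x~y) = Fin.toℕ-injective (ℤ.+-injective (ℤ.i-j≡0⇒i≡j (ι x) (ι y)
    (ℤ.∣i∣≡0⇒i≡0 (small (∣⇒∣ᵤ x~y) bound))))
    where
    bound : ℤ.∣ ι x ℤ.- ι y ∣ < q
    bound = ℕ.≤-<-trans
      (subst (λ z → ℤ.∣ z ∣ ≤ toℕ x ℕ.⊔ toℕ y) (sym (ℤ.m-n≡m⊖n (toℕ x) (toℕ y))) (ℤ.∣m⊝n∣≤m⊔n (toℕ x) (toℕ y)))
      (ℕ.⊔-lub (Fin.toℕ<n x) (Fin.toℕ<n y))
    small : ∀ {d} → q ℕ.∣ d → d < q → d ≡ 0
    small {zero}  _   _   = refl
    small {suc d} q∣d d<q = contradiction q∣d (ℕ.>⇒∤ d<q)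

  []-cong : ∀ a b → a ~ b → [ a ] ≡ [ b ]
  []-cong a b a~b = ι-injective (~-trans (~-sym ι[ a ]) (~-trans a~b ι[ b ]))

  [ι_] : ∀ x → [ ι x ] ≡ x
  [ι x ] = ι-injective (~-sym ι[ ι x ])

  infixl 6 _+_ _-_
  infixl 7 _*_
  infix 8 -_

  -- Opacity keeps sums and products of residues from unfolding into division with remainder.
  opaque

    _+_ _*_ : Z → Z → Z
    x + y = [ ι x ℤ.+ ι y ]
    x * y = [ ι x ℤ.* ι y ]

    -_ : Z → Z
    - x = [ ℤ.- ι x ]

    +-homo : ∀ a b → [ a ℤ.+ b ] ≡ [ a ] + [ b ]
    +-homo a b = []-cong (a ℤ.+ b) (ι [ a ] ℤ.+ ι [ b ]) (mk~ (subst (+ q ℤ.∣_)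
      (solve 4 (λ a b a′ b′ → (a :- a′) :+ (b :- b′) := (a :+ b) :- (a′ :+ b′)) refl a b (ι [ a ]) (ι [ b ]))
      (ℤ.∣m∣n⇒∣m+n (div ι[ a ]) (div ι[ b ]))))
      where open ℤ.+-*-Solver

    *-homo : ∀ a b → [ a ℤ.* b ] ≡ [ a ] * [ b ]
    *-homo a b = []-cong (a ℤ.* b) (ι [ a ] ℤ.* ι [ b ]) (mk~ (subst (+ q ℤ.∣_)
      (solve 4 (λ a b a′ b′ → (a :- a′) :* b :+ a′ :* (b :- b′) := (a :* b) :- (a′ :* b′)) refl
        a b (ι [ a ]) (ι [ b ]))
      (ℤ.∣m∣n⇒∣m+n (ℤ.∣m⇒∣m*n b (div ι[ a ])) (ℤ.∣n⇒∣m*n (ι [ a ]) (div ι[ b ])))))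
      where open ℤ.+-*-Solver

    -‿homo : ∀ a → [ ℤ.- a ] ≡ - [ a ]
    -‿homo a = []-cong (ℤ.- a) (ℤ.- ι [ a ]) (mk~ (subst (+ q ℤ.∣_)
      (solve 2 (λ a a′ → :- (a :- a′) := (:- a) :- (:- a′)) refl a (ι [ a ])) (ℤ.∣m⇒∣-m (div ι[ a ]))))
      where open ℤ.+-*-Solver

    +-comm : ∀ x y → x + y ≡ y + x
    +-comm x y = cong [_] (ℤ.+-comm (ι x) (ι y))

    *-comm : ∀ x y → x * y ≡ y * x
    *-comm x y = cong [_] (ℤ.*-comm (ι x) (ι y))

  _-_ : Z → Z → Z
  x - y = x + (- y)

  private
    -- Every law of Z is the image of the same law of ℤ.
    elim : (P : Z → Set) → (∀ a → P [ a ]) → ∀ x → P x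
    elim P p x = subst P [ι x ] (p (ι x))

    law₂ : ∀ {f g : Z → Z → Z} → (∀ a b → f [ a ] [ b ] ≡ g [ a ] [ b ]) → ∀ x y → f x y ≡ g x y
    law₂ {f} {g} p x y = subst₂ (λ x y → f x y ≡ g x y) [ι x ] [ι y ] (p (ι x) (ι y))

    law₃ : ∀ {f g : Z → Z → Z → Z} → (∀ a b c → f [ a ] [ b ] [ c ] ≡ g [ a ] [ b ] [ c ]) →
           ∀ x y z → f x y z ≡ g x y z
    law₃ {f} {g} p x y z = subst (λ z → f x y z ≡ g x y z) [ι z ] (law₂ (λ a b → p a b (ι z)) x y)

    +-assoc : ∀ x y z → (x + y) + z ≡ x + (y + z)
    +-assoc = law₃ λ a b c → trans (trans (cong (_+ [ c ]) (sym (+-homo a b))) (sym (+-homo (a ℤ.+ b) c)))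
      (trans (cong [_] (ℤ.+-assoc a b c)) (trans (+-homo a (b ℤ.+ c)) (cong (λ z → [ a ] + z) (+-homo b c))))

    *-assoc : ∀ x y z → (x * y) * z ≡ x * (y * z)
    *-assoc = law₃ λ a b c → trans (trans (cong (_* [ c ]) (sym (*-homo a b))) (sym (*-homo (a ℤ.* b) c)))
      (trans (cong [_] (ℤ.*-assoc a b c)) (trans (*-homo a (b ℤ.* c)) (cong ([ a ] *_) (*-homo b c))))

    +-identityˡ : ∀ x → [ + 0 ] + x ≡ x
    +-identityˡ = elim _ λ a → trans (sym (+-homo (+ 0) a)) (cong [_] (ℤ.+-identityˡ a))

    *-identityˡ : ∀ x → [ + 1 ] * x ≡ x
    *-identityˡ = elim _ λ a → trans (sym (*-homo (+ 1) a)) (cong [_] (ℤ.*-identityˡ a))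

    -‿inverseˡ : ∀ x → - x + x ≡ [ + 0 ]
    -‿inverseˡ = elim _ λ a → trans (cong (_+ [ a ]) (sym (-‿homo a)))
      (trans (sym (+-homo (ℤ.- a) a)) (cong [_] (ℤ.+-inverseˡ a)))

    distribˡ : ∀ x y z → x * (y + z) ≡ x * y + x * z
    distribˡ = law₃ λ a b c → trans (trans (cong ([ a ] *_) (sym (+-homo b c))) (sym (*-homo a (b ℤ.+ c))))
      (trans (cong [_] (ℤ.*-distribˡ-+ a b c))
        (trans (+-homo (a ℤ.* b) (a ℤ.* c)) (cong₂ _+_ (*-homo a b) (*-homo a c))))

  commutativeRing : CommutativeRing 0ℓ 0ℓ
  commutativeRing = record
    { _≈_ = _≡_ ; _+_ = _+_ ; _*_ = _*_ ; -_ = -_ ; 0# = [ + 0 ] ; 1# = [ + 1 ]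
    ; isCommutativeRing = record
      { isRing = record
        { +-isAbelianGroup = record
          { isGroup = record
            { isMonoid = record
              { isSemigroup = record
                { isMagma = record { isEquivalence = isEquivalence ; ∙-cong = cong₂ _+_ }
                ; assoc = +-assoc }
              ; identity = Consequences.comm∧idˡ⇒id +-comm +-identityˡ }
            ; inverse = Consequences.comm∧invˡ⇒inv +-comm -‿inverseˡ
            ; ⁻¹-cong = cong (λ x → - x) }
          ; comm = +-comm }
        ; *-cong = cong₂ _*_
        ; *-assoc = *-assoc
        ; *-identity = Consequences.comm∧idˡ⇒id *-comm *-identityˡ
        ; distrib = distribˡ , Consequences.comm∧distrˡ⇒distrʳ *-comm distribˡ }
      ; *-comm = *-comm } }

  private
    morphism : CommutativeRing.rawRing ℤ.+-*-commutativeRing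
                 -Raw-AlmostCommutative⟶ fromCommutativeRing commutativeRing
    morphism = record
      { ⟦_⟧ = [_] ; +-homo = +-homo ; *-homo = *-homo ; -‿homo = -‿homo ; 0-homo = refl ; 1-homo = refl }

  -- The coefficients are integers and `con a` denotes `[ a ]`, so that identities involving the
  -- slopes 1, 2 and 3 are polynomial identities.
  module Solver = Algebra.Solver.Ring (CommutativeRing.rawRing ℤ.+-*-commutativeRing)
    (fromCommutativeRing commutativeRing) morphism
    (λ a b → Maybe.map (cong [_]) (dec⇒maybe (a ℤ.≟ b)))

  Inverts : ℤ → Z → Set
  Inverts a x = [ a ] * x ≡ [ + 1 ]

  inverses : ∀ a b k → a ℕ.* b ≡ 1 ℕ.+ k ℕ.* q → Inverts (+ a) [ + b ]
  inverses a b k eq = trans (sym (*-homo (+ a) (+ b))) ([]-cong (+ a ℤ.* + b) (+ 1) (mk~ (divides (+ k) (begin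
    + a ℤ.* + b ℤ.- + 1          ≡⟨ cong (ℤ._- + 1) (ℤ.pos-* a b) ⟨
    + (a ℕ.* b) ℤ.- + 1          ≡⟨ cong (λ z → + z ℤ.- + 1) eq ⟩
    + (k ℕ.* q)                  ≡⟨ ℤ.pos-* k q ⟩
    + k ℤ.* + q                  ∎))))
    where open ≡-Reasoning

-- h and t are the inverses of 2 and 3.
module Slopes (n : ℕ) (h t : Fin (suc n))
  (2h≡1 : ℤmod.Inverts n (+ 2) h)
  (3t≡1 : ℤmod.Inverts n (+ 3) t) where

  open ℤmod n
  open Solver

  slope : Fin 3 → Z
  slope 0F = [ + 1 ]
  slope 1F = [ + 2 ]
  slope 2F = [ + 3 ]

  slope⁻¹ : Fin 3 → Z
  slope⁻¹ 0F = [ + 1 ]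
  slope⁻¹ 1F = h
  slope⁻¹ 2F = t

  at : Fin 3 → Z → Z → Z
  at k x e = slope k * x + e

  at-slope : ∀ k x e → at k x e - slope k * x ≡ e
  at-slope k x e = solve 2 (λ y e → y :+ e :- y := e) refl (slope k * x) e

  private
    2h : ∀ x → [ + 2 ] * h * x ≡ x
    2h x = trans (cong (_* x) 2h≡1) (solve 1 (λ x → con (+ 1) :* x := x) refl x)

    3t : ∀ x → [ + 3 ] * t * x ≡ x
    3t x = trans (cong (_* x) 3t≡1) (solve 1 (λ x → con (+ 1) :* x := x) refl x)

  -- The class whose triple number `e` has `p` as its vertex in group `k`. It exists because the
  -- slopes are units.
  class-at : Fin 3 → Z → Z → Z
  class-at k e p = slope⁻¹ k * (p - e)

  class-at-at : ∀ k x e → class-at k e (at k x e) ≡ x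
  class-at-at 0F x e = solve 2 (λ x e → con (+ 1) :* (con (+ 1) :* x :+ e :- e) := x) refl x e
  class-at-at 1F x e = trans
    (solve 3 (λ x e h → h :* (con (+ 2) :* x :+ e :- e) := con (+ 2) :* h :* x) refl x e h)
    (2h x)
  class-at-at 2F x e = trans
    (solve 3 (λ x e t → t :* (con (+ 3) :* x :+ e :- e) := con (+ 3) :* t :* x) refl x e t)
    (3t x)

  gap⁻¹ : Fin 3 → Fin 3 → Z
  gap⁻¹ 0F 1F = [ + 1 ]
  gap⁻¹ 1F 2F = [ + 1 ]
  gap⁻¹ 0F 2F = h
  gap⁻¹ 2F 0F = - h
  -- This is right for the gap -1 from B to A and from C to B; on the diagonal it is a filler.
  gap⁻¹ _  _  = - [ + 1 ]

  -- In class x the vertices of a triple in groups `k` and `l` differ by (l - k)x, whatever its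
  -- number, so dividing by the gap gives x.
  class-of : Fin 3 → Fin 3 → Z → Z → Z
  class-of k l p p′ = gap⁻¹ k l * (p′ - p)

  class-of-at : ∀ {k l} → k ≢ l → ∀ x e → class-of k l (at k x e) (at l x e) ≡ x
  class-of-at {0F} {1F} _ =
    solve 2 (λ x e → con (+ 1) :* ((con (+ 2) :* x :+ e) :- (con (+ 1) :* x :+ e)) := x) refl
  class-of-at {1F} {2F} _ =
    solve 2 (λ x e → con (+ 1) :* ((con (+ 3) :* x :+ e) :- (con (+ 2) :* x :+ e)) := x) refl
  class-of-at {1F} {0F} _ =
    solve 2 (λ x e → :- con (+ 1) :* ((con (+ 1) :* x :+ e) :- (con (+ 2) :* x :+ e)) := x) refl
  class-of-at {2F} {1F} _ =
    solve 2 (λ x e → :- con (+ 1) :* ((con (+ 2) :* x :+ e) :- (con (+ 3) :* x :+ e)) := x) refl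
  class-of-at {0F} {2F} _ x e = trans
    (solve 3 (λ x e h → h :* ((con (+ 3) :* x :+ e) :- (con (+ 1) :* x :+ e)) := con (+ 2) :* h :* x) refl x e h)
    (2h x)
  class-of-at {2F} {0F} _ x e = trans
    (solve 3 (λ x e h → (:- h) :* ((con (+ 1) :* x :+ e) :- (con (+ 3) :* x :+ e)) := con (+ 2) :* h :* x) refl x e h)
    (2h x)
  class-of-at {0F} {0F} k≢l = contradiction refl k≢l
  class-of-at {1F} {1F} k≢l = contradiction refl k≢l
  class-of-at {2F} {2F} k≢l = contradiction refl k≢l

  net : Design Z (const Z) (Fin 3 × Z)
  net = certified
    (λ x e k → k , at k x e)
    (λ x (k , p) → p - slope k * x , k)
    (λ x e k → cong (_, k) (at-slope k x e))
    (λ (k , p) (l , p′) → class-of k l p p′)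
    (λ x e k≢l → class-of-at k≢l x e)

  -- For a fixed number `e`, a vertex determines its class, since the slope of its group is a unit.
  net-rainbow : ∀ e → ∀ {x x′ k k′} → (k , at k x e) ≡ (k′ , at k′ x′ e) → x ≡ x′
  net-rainbow e {x} {x′} {k} {k′} eq = trans (sym (class-at-at k x e))
    (trans (cong (λ (k , p) → class-at k e p) eq) (class-at-at k′ x′ e))

module _ {q c : ℕ} where

  encode : (Fin 3 × Fin q) ⊎ Fin c → Fin (3 ℕ.* q ℕ.+ c)
  encode = join (3 ℕ.* q) c ∘ Sum.map₁ (uncurry combine)

  decode : Fin (3 ℕ.* q ℕ.+ c) → (Fin 3 × Fin q) ⊎ Fin c
  decode = Sum.map₁ (remQuot q) ∘ splitAt (3 ℕ.* q)

  decode-encode : ∀ p → decode (encode p) ≡ p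
  decode-encode p = trans
    (cong (Sum.map₁ (remQuot q)) (Fin.splitAt-join (3 ℕ.* q) c (Sum.map₁ (uncurry combine) p))) (lemma p)
    where
    lemma : ∀ p → Sum.map₁ (remQuot q) (Sum.map₁ (uncurry combine) p) ≡ p
    lemma (inj₁ (k , x)) = cong inj₁ (Fin.remQuot-combine k x)
    lemma (inj₂ j)       = refl

-- Designs with q and with q - 1 classes

module NetDesigns (n : ℕ) (h t : Fin (suc n))
  (2h≡1 : ℤmod.Inverts n (+ 2) h)
  (3t≡1 : ℤmod.Inverts n (+ 3) t) where

  open ℤmod n
  open Solver
  open Slopes n h t 2h≡1 3t≡1

  full : RainbowDesign q (3 ℕ.* q ℕ.+ 2)
  full = restrict net R , restrict-rainbow net R (const zero) (const zero) (λ _ → refl) (net-rainbow zero)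
    where
    R : Restriction net
    R = record
      -- Only finite points are coded; the two additional points, which bring the count to 3q + 2,
      -- lie on no triple.
      { pt′        = λ x e k → encode {q} {2} (inj₁ (k , at k x e))
      ; class      = id
      ; triple     = λ _ → id
      ; point      = [ id , const (0F , zero) ]′ ∘ decode {q} {2}
      ; class-inj  = id
      ; triple-inj = λ _ → id
      ; point-pt′  = λ x e k → cong [ id , const (0F , zero) ]′ (decode-encode {q} {2} (inj₁ (k , at k x e)))
      }

  private
    3y≡0⇒y≡0 : ∀ y → - ([ + 3 ] * y) ≡ [ + 0 ] → y ≡ [ + 0 ]
    3y≡0⇒y≡0 y eq = begin
      y                          ≡⟨ solve 1 (λ y → y := con (+ 1) :* y) refl y ⟩
      [ + 1 ] * y                ≡⟨ cong (_* y) (sym 3t≡1) ⟩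
      [ + 3 ] * t * y            ≡⟨ solve 2 (λ y t → con (+ 3) :* t :* y := :- (t :* :- (con (+ 3) :* y)))
                                      refl y t ⟩
      - (t * - ([ + 3 ] * y))    ≡⟨ cong (λ z → - (t * z)) eq ⟩
      - (t * [ + 0 ])            ≡⟨ solve 1 (λ t → :- (t :* con (+ 0)) := con (+ 0)) refl t ⟩
      [ + 0 ]                    ∎
      where open ≡-Reasoning

    y+e≡0⇒e≡-y : ∀ y e → y + e ≡ [ + 0 ] → e ≡ - y
    y+e≡0⇒e≡-y y e eq = begin
      e            ≡⟨ solve 2 (λ y e → e := (y :+ e) :- y) refl y e ⟩
      y + e - y    ≡⟨ cong (_- y) eq ⟩
      [ + 0 ] - y  ≡⟨ solve 1 (λ y → con (+ 0) :- y := :- y) refl y ⟩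
      - y          ∎
      where open ≡-Reasoning

  -- Delete the class 0 and the point 0 of the third group.
  punctured : RainbowDesign n (3 ℕ.* suc n ℕ.∸ 1)
  punctured = restrict net R , restrict-rainbow net R (const zero) (λ x → punchOut (e≢0 x))
      (λ x → Fin.punchIn-punchOut (e≢0 x)) (net-rainbow zero)
    where
    e₀ : Fin n → Z
    e₀ x = - ([ + 3 ] * suc x)

    -- As 3 is a unit, the deleted point lies on the rainbow triple 0 only in the deleted class 0,
    -- so the rainbow survives in all other classes.
    e≢0 : ∀ x → e₀ x ≢ zero
    e≢0 x eq = contradiction (3y≡0⇒y≡0 (suc x) eq) λ()

    0≢C : ∀ x j → zero ≢ at 2F (suc x) (punchIn (e₀ x) j)
    0≢C x j eq = Fin.punchInᵢ≢i (e₀ x) j (y+e≡0⇒e≡-y ([ + 3 ] * suc x) (punchIn (e₀ x) j) (sym eq))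

    -- The number `3 * suc n ∸ 1` computes to `n + (q + (q + 0))`, so group C, the one that has lost
    -- a point, comes first.
    pt′ : Fin n → Fin n → Fin 3 → Fin (n ℕ.+ (q ℕ.+ (q ℕ.+ 0)))
    pt′ x j 0F = n ↑ʳ (at 0F (suc x) (punchIn (e₀ x) j) ↑ˡ (q ℕ.+ 0))
    pt′ x j 1F = n ↑ʳ (q ↑ʳ (at 1F (suc x) (punchIn (e₀ x) j) ↑ˡ 0))
    pt′ x j 2F = punchOut (0≢C x j) ↑ˡ (q ℕ.+ (q ℕ.+ 0))

    point : Fin (n ℕ.+ (q ℕ.+ (q ℕ.+ 0))) → Fin 3 × Z
    point = [ (λ c → 2F , suc c) , [ (0F ,_) , [ (1F ,_) , (λ ()) ]′ ∘ splitAt q ]′ ∘ splitAt q ]′ ∘ splitAt n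

    point-A : ∀ a → point (n ↑ʳ (a ↑ˡ (q ℕ.+ 0))) ≡ (0F , a)
    point-A a = trans
      (cong [ _ , _ ]′ (Fin.splitAt-↑ʳ n _ (a ↑ˡ (q ℕ.+ 0)))) (cong [ _ , _ ]′ (Fin.splitAt-↑ˡ q a (q ℕ.+ 0)))

    point-B : ∀ b → point (n ↑ʳ (q ↑ʳ (b ↑ˡ 0))) ≡ (1F , b)
    point-B b = trans (cong [ _ , _ ]′ (Fin.splitAt-↑ʳ n _ (q ↑ʳ (b ↑ˡ 0)))) (trans
      (cong [ _ , _ ]′ (Fin.splitAt-↑ʳ q (q ℕ.+ 0) (b ↑ˡ 0))) (cong [ _ , _ ]′ (Fin.splitAt-↑ˡ q b 0)))

    point-C : ∀ {c} (0≢c : zero ≢ c) → point (punchOut 0≢c ↑ˡ (q ℕ.+ (q ℕ.+ 0))) ≡ (2F , c)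
    point-C 0≢c = trans
      (cong [ _ , _ ]′ (Fin.splitAt-↑ˡ n (punchOut 0≢c) _)) (cong (2F ,_) (Fin.punchIn-punchOut 0≢c))

    point-pt′ : ∀ x j k → point (pt′ x j k) ≡ (k , at k (suc x) (punchIn (e₀ x) j))
    point-pt′ x j 0F = point-A _
    point-pt′ x j 1F = point-B _
    point-pt′ x j 2F = point-C (0≢C x j)

    R : Restriction net
    R = record
      { pt′        = pt′
      ; class      = suc
      ; triple     = λ x → punchIn (e₀ x)
      ; point      = point
      ; class-inj  = Fin.suc-injective
      ; triple-inj = λ x → Fin.punchIn-injective (e₀ x) _ _
      ; point-pt′  = point-pt′
      }

-- Growing a net by one or two classes

-- A vertex of a special triple: the point 0 of one of the three groups, or an
-- infinite point.
Corner : Set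
Corner = Fin 3 ⊎ Fin 8

_≟ᶜ_ : (v w : Corner) → Dec (v ≡ w)
_≟ᶜ_ = Sum.≡-dec Fin._≟_ Fin._≟_

-- The numbers e with A(x + e), B(2x + e), C(3x + e) broken up in class x are 0, 5
-- (C replaced by an infinite point) and 2, 3 (A replaced). The vertices left over
-- form the broken triples 4 and 5: the pair A(x + 2), C(3x) lies in the broken-up
-- triple 3 of class x - 1, and A(x + 3), C(3x + 5) in the broken-up triple 2 of
-- class x + 1. The entry (k , c) stands for the point (k + 1)x + c of group k, and
-- the third vertex of the broken triple b is the infinite point b.
broken-base : Fin 6 → Fin 2 → Fin 3 × ℕ
broken-base 0F 0F = 0F , 0
broken-base 0F 1F = 1F , 0
broken-base 1F 0F = 0F , 5
broken-base 1F 1F = 1F , 5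
broken-base 2F 0F = 1F , 2
broken-base 2F 1F = 2F , 2
broken-base 3F 0F = 1F , 3
broken-base 3F 1F = 2F , 3
broken-base 4F 0F = 0F , 2
broken-base 4F 1F = 2F , 0
broken-base 5F 0F = 0F , 3
broken-base 5F 1F = 2F , 5

-- offset k j is the c for which (k + 1)x + c is joined to the infinite point j in
-- class x; nothing means that these pairs are left for the new classes.
offset : Fin 3 → Fin 8 → Maybe ℕ
offset 0F 0F = just 0
offset 0F 1F = just 5
offset 0F 4F = just 2
offset 0F 5F = just 3
offset 1F 0F = just 0
offset 1F 1F = just 5
offset 1F 2F = just 2
offset 1F 3F = just 3
offset 2F 2F = just 2
offset 2F 3F = just 3
offset 2F 4F = just 0
offset 2F 5F = just 5
offset _  _  = nothing

-- special n a lists the vertices of the a-th special triple of the new class n.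
-- The special triples 0 belong to the rainbow, so they consist of infinite points.
module Cap (special : Fin 2 → Fin 3 → Fin 3 → Corner) where

  -- The new class of a pair of vertices. Every pair outside the special triples of class 0 is given
  -- to class 1; `Hued` states that this is right on all special triples.
  hue : Corner → Corner → Fin 2
  hue v w = if does (Fin.any? λ a → Fin.any? λ b → Fin.any? λ c →
                     special 0F a b ≟ᶜ v ×-dec special 0F a c ≟ᶜ w)
            then 0F else 1F

  seek : Fin 2 → Corner → Fin 3 × Fin 3
  seek n v with (Fin.any? λ a → Fin.any? λ b → special n a b ≟ᶜ v)
  ... | yes (a , b , _) = a , b
  ... | no _            = 0F , 0F

  rainbow-hue : Corner → Fin 2
  rainbow-hue v = if does (Fin.any? λ b → special 0F 0F b ≟ᶜ v) then 0F else 1F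

  Hued : Set
  Hued = ∀ n a b c → b ≢ c → hue (special n a b) (special n a c) ≡ n

  Sought : Set
  Sought = ∀ n a b → seek n (special n a b) ≡ (a , b)

  -- Where `offset k j` is `just c`, the old classes join the infinite point `j` to every point of
  -- group `k`, as the slope is a unit. So the corner `k` may meet `j` in a special triple only
  -- where the offset is `nothing`.
  Free : Set
  Free = ∀ n a b c → b ≢ c → ∀ k → special n a b ≡ inj₁ k →
         ∃[ j ] (special n a c ≡ inj₂ j × offset k j ≡ nothing)

  module _ (g : ℕ) (g≤2 : g ≤ 2) where

    Bounded : Set
    Bounded = ∀ (m : Fin g) (a : Fin (suc g)) b j →
      special (inject≤ m g≤2) (inject≤ a (s≤s g≤2)) b ≡ inj₂ j → toℕ j < 2 ℕ.+ 3 ℕ.* g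

    Rainbowed : Set
    Rainbowed = ∀ (m : Fin g) b →
      ∃[ j ] (special (inject≤ m g≤2) 0F b ≡ inj₂ j × rainbow-hue (inj₂ j) ≡ inject≤ m g≤2)

    bounded? : Dec Bounded
    bounded? = Fin.all? λ m → Fin.all? λ a → Fin.all? λ b → Fin.all? λ j →
      (special (inject≤ m g≤2) (inject≤ a (s≤s g≤2)) b ≟ᶜ inj₂ j) →-dec (toℕ j ℕ.<? 2 ℕ.+ 3 ℕ.* g)

    rainbowed? : Dec Rainbowed
    rainbowed? = Fin.all? λ m → Fin.all? λ b → Fin.any? λ j →
      special (inject≤ m g≤2) 0F b ≟ᶜ inj₂ j ×-dec rainbow-hue (inj₂ j) Fin.≟ inject≤ m g≤2

  hued? : Dec Hued
  hued? = Fin.all? λ n → Fin.all? λ a → Fin.all? λ b → Fin.all? λ c →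
    ¬? (b Fin.≟ c) →-dec hue (special n a b) (special n a c) Fin.≟ n

  sought? : Dec Sought
  sought? = Fin.all? λ n → Fin.all? λ a → Fin.all? λ b →
    Product.≡-dec Fin._≟_ Fin._≟_ (seek n (special n a b)) (a , b)

  free? : Dec Free
  free? = Fin.all? λ n → Fin.all? λ a → Fin.all? λ b → Fin.all? λ c → ¬? (b Fin.≟ c) →-dec
    (Fin.all? λ k → (special n a b ≟ᶜ inj₁ k) →-dec
      Fin.any? λ j → special n a c ≟ᶜ inj₂ j ×-dec Maybe.≡-dec ℕ._≟_ (offset k j) nothing)

-- Triples inside the groups

module Parts (s : ℕ) where

  -- Two partitions of the nonzero points of a group: into runs of three consecutive numbers, and
  -- into triples with common difference `s`. The point 0 remains for the special triples.
  part : Fin 2 → Fin s → Fin 3 → Fin (suc (s ℕ.* 3))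
  part 0F i v = suc (combine i v)
  part 1F i v = suc (cast (ℕ.*-comm 3 s) (combine v i))

  part⁻¹ : Fin 2 → Fin (s ℕ.* 3) → Fin s × Fin 3
  part⁻¹ 0F p = remQuot 3 p
  part⁻¹ 1F p = swap (remQuot s (cast (ℕ.*-comm s 3) p))

  part⁻¹-part : ∀ m i v → ∃[ p ] (part m i v ≡ suc p × part⁻¹ m p ≡ (i , v))
  part⁻¹-part 0F i v = _ , refl , Fin.remQuot-combine i v
  part⁻¹-part 1F i v = _ , refl , trans
    (cong (swap ∘ remQuot s) (Fin.cast-involutive (ℕ.*-comm s 3) (ℕ.*-comm 3 s) (combine v i)))
    (cong swap (Fin.remQuot-combine v i))

  pure-hue : Fin (suc (s ℕ.* 3)) → Fin (suc (s ℕ.* 3)) → Fin 2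
  pure-hue (suc p) (suc p′) = if does (quotient {s} 3 p Fin.≟ quotient {s} 3 p′) then 0F else 1F
  pure-hue _       _        = 0F

  pure-hue-refl : ∀ p p′ → quotient {s} 3 p ≡ quotient 3 p′ → pure-hue (suc p) (suc p′) ≡ 0F
  pure-hue-refl p p′ eq with quotient {s} 3 p Fin.≟ quotient 3 p′
  ... | yes _  = refl
  ... | no neq = contradiction eq neq

  pure-hue-≢ : ∀ p p′ → quotient {s} 3 p ≢ quotient 3 p′ → pure-hue (suc p) (suc p′) ≡ 1F
  pure-hue-≢ p p′ neq with quotient {s} 3 p Fin.≟ quotient 3 p′
  ... | yes eq = contradiction eq neq
  ... | no _   = refl

  toℕ-quotient : ∀ (p : Fin (s ℕ.* 3)) → ∃[ r ] toℕ p ≡ 3 ℕ.* toℕ (quotient {s} 3 p) ℕ.+ toℕ {3} r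
  toℕ-quotient p = let i , r = remQuot {s} 3 p in
    r , trans (cong toℕ (sym (Fin.combine-remQuot {s} 3 p))) (Fin.toℕ-combine i r)

  -- Members of a triple of the second kind differ by at least `s`, hence by at least 3, and a run
  -- of three consecutive numbers cannot contain both.
  quotient-cast : 3 ≤ s → ∀ {v w : Fin 3} {i : Fin s} → v Fin.< w →
    quotient {s} 3 (cast (ℕ.*-comm 3 s) (combine v i)) ≢ quotient {s} 3 (cast (ℕ.*-comm 3 s) (combine w i))
  quotient-cast 3≤s {v} {w} {i} v<w eq with toℕ-quotient (cast (ℕ.*-comm 3 s) (combine v i))
                                     | toℕ-quotient (cast (ℕ.*-comm 3 s) (combine w i))
  ... | r , eq₁ | r′ , eq₂ = ℕ.<-irrefl refl (begin-strict
    s ℕ.* toℕ w ℕ.+ toℕ i            ≡⟨ Fin.toℕ-combine w i ⟨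
    toℕ (combine w i)                ≡⟨ Fin.toℕ-cast (ℕ.*-comm 3 s) (combine w i) ⟨
    toℕ (cast (ℕ.*-comm 3 s) (combine w i)) ≡⟨ eq₂ ⟩
    3 ℕ.* toℕ Q′ ℕ.+ toℕ r′          <⟨ ℕ.+-monoʳ-< (3 ℕ.* toℕ Q′) (Fin.toℕ<n r′) ⟩
    3 ℕ.* toℕ Q′ ℕ.+ 3               ≡⟨ cong (λ Q → 3 ℕ.* toℕ Q ℕ.+ 3) eq ⟨
    3 ℕ.* toℕ Q ℕ.+ 3                ≤⟨ ℕ.+-mono-≤ (ℕ.m≤m+n _ (toℕ r)) 3≤s ⟩
    3 ℕ.* toℕ Q ℕ.+ toℕ r ℕ.+ s      ≡⟨ cong (ℕ._+ s) eq₁ ⟨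
    toℕ (cast (ℕ.*-comm 3 s) (combine v i)) ℕ.+ s ≡⟨ cong (ℕ._+ s) (Fin.toℕ-cast (ℕ.*-comm 3 s) (combine v i)) ⟩
    toℕ (combine v i) ℕ.+ s          ≡⟨ cong (ℕ._+ s) (Fin.toℕ-combine v i) ⟩
    s ℕ.* toℕ v ℕ.+ toℕ i ℕ.+ s      ≡⟨ ℕ.+-comm _ s ⟩
    s ℕ.+ (s ℕ.* toℕ v ℕ.+ toℕ i)    ≡⟨ ℕ.+-assoc s _ _ ⟨
    s ℕ.+ s ℕ.* toℕ v ℕ.+ toℕ i      ≡⟨ cong (ℕ._+ toℕ i) (ℕ.*-suc s (toℕ v)) ⟨
    s ℕ.* suc (toℕ v) ℕ.+ toℕ i      ≤⟨ ℕ.+-monoˡ-≤ (toℕ i) (ℕ.*-monoʳ-≤ s v<w) ⟩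
    s ℕ.* toℕ w ℕ.+ toℕ i            ∎)
    where
    open ℕ.≤-Reasoning
    Q  = quotient {s} 3 (cast (ℕ.*-comm 3 s) (combine v i))
    Q′ = quotient {s} 3 (cast (ℕ.*-comm 3 s) (combine w i))

  pure-hue-part : 3 ≤ s → ∀ m i {v w} → v ≢ w → pure-hue (part m i v) (part m i w) ≡ m
  pure-hue-part _ 0F i {v} {w} _ = pure-hue-refl (combine i v) (combine i w)
    (trans (cong proj₁ (Fin.remQuot-combine i v)) (sym (cong proj₁ (Fin.remQuot-combine i w))))
  pure-hue-part 3≤s 1F i {v} {w} v≢w = pure-hue-≢ _ _ λ eq → case (Fin.<-cmp v w) of λ
    { (tri< v<w _ _) → quotient-cast 3≤s v<w eq
    ; (tri≈ _ v≡w _) → v≢w v≡w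
    ; (tri> _ _ w<v) → quotient-cast 3≤s w<v (sym eq) }

-- The grown design with two new classes

module Growth (s′ : ℕ) (h t : Fin (suc ((3 ℕ.+ s′) ℕ.* 3)))
  (2h≡1 : ℤmod.Inverts ((3 ℕ.+ s′) ℕ.* 3) (+ 2) h)
  (3t≡1 : ℤmod.Inverts ((3 ℕ.+ s′) ℕ.* 3) (+ 3) t)
  (special : Fin 2 → Fin 3 → Fin 3 → Corner)
  (hued : Cap.Hued special) (sought : Cap.Sought special) (free : Cap.Free special)
  where

  s n : ℕ
  s = 3 ℕ.+ s′
  n = s ℕ.* 3

  open ℤmod n
  open Solver
  open Slopes n h t 2h≡1 3t≡1
  open Cap special
  open Parts s

  -- The index of e in the list 0, 5, 2, 3 of triples that are broken up.
  find : Z → Maybe (Fin 4)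
  find zero                                = just 0F
  find (suc (suc zero))                    = just 2F
  find (suc (suc (suc zero)))              = just 3F
  find (suc (suc (suc (suc (suc zero)))))  = just 1F
  find _                                   = nothing

  -- The proof inside `regular` is irrelevant, so that only the number matters for equality of
  -- triples; evaluating `find e` regains a relevant proof.
  find-regular : ∀ {e} → .(find e ≡ nothing) → find e ≡ nothing
  find-regular {e} eq with find e
  ... | nothing = refl

  data Old : Set where
    regular : (e : Z) → .(find e ≡ nothing) → Old
    broken  : Fin 6 → Old

  data New : Set where
    pure : Fin 3 → Fin s → New
    spec : Fin 3 → New

  Class : Set
  Class = Z ⊎ Fin 2

  Triple : Class → Set
  Triple (inj₁ _) = Old
  Triple (inj₂ _) = New

  Point : Set
  Point = (Fin 3 × Z) ⊎ Fin 8

  corner : Corner → Point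
  corner = Sum.map₁ (_, zero)

  base-point : Fin 6 → Fin 2 → Z → Fin 3 × Z
  base-point b v x = let k , c = broken-base b v in k , at k x [ + c ]

  pt : ∀ k → Triple k → Fin 3 → Point
  pt (inj₁ x) (regular e _) k  = inj₁ (k , at k x e)
  pt (inj₁ x) (broken b)    0F = inj₁ (base-point b 0F x)
  pt (inj₁ x) (broken b)    1F = inj₁ (base-point b 1F x)
  pt (inj₁ x) (broken b)    2F = inj₂ (b ↑ˡ 2)
  pt (inj₂ m) (pure k i)    v  = inj₁ (k , part m i v)
  pt (inj₂ m) (spec a)      v  = corner (special m a v)

  -- The inverse of `broken-base`: the broken triple and position that receive the vertex in group
  -- `k` of the broken-up triple with index `i`.
  broken-vertex : Fin 3 → Fin 4 → Fin 6 × Fin 3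
  broken-vertex 0F 0F = 0F , 0F
  broken-vertex 0F 1F = 1F , 0F
  broken-vertex 0F 2F = 4F , 0F
  broken-vertex 0F 3F = 5F , 0F
  broken-vertex 1F 0F = 0F , 1F
  broken-vertex 1F 1F = 1F , 1F
  broken-vertex 1F 2F = 2F , 0F
  broken-vertex 1F 3F = 3F , 0F
  broken-vertex 2F 0F = 4F , 1F
  broken-vertex 2F 1F = 5F , 1F
  broken-vertex 2F 2F = 2F , 1F
  broken-vertex 2F 3F = 3F , 1F

  -- The value of `find e` is an argument with its equation, so that the number `e` can be replaced
  -- by `cong` alone.
  old-vertex : Fin 3 → (e : Z) (m : Maybe (Fin 4)) → .(find e ≡ m) → Old × Fin 3
  old-vertex k e (just i) _  = let b , v = broken-vertex k i in broken b , v
  old-vertex k e nothing  eq = regular e eq , k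

  old-inf : Fin 8 → Old × Fin 3
  -- The infinite points 6 and 7 lie on no old triple; the second value is a filler.
  old-inf j = [ (λ b → broken b , 2F) , const (broken 0F , 0F) ]′ (splitAt 6 j)

  new-corner : Fin 2 → Corner → New × Fin 3
  new-corner m v = let a , b = seek m v in spec a , b

  locate : ∀ k → Point → Triple k × Fin 3
  locate (inj₁ x) (inj₁ (k , p))     = let e = p - slope k * x in old-vertex k e (find e) refl
  locate (inj₁ x) (inj₂ j)           = old-inf j
  locate (inj₂ m) (inj₁ (k , zero))  = new-corner m (inj₁ k)
  locate (inj₂ m) (inj₁ (k , suc p)) = let i , v = part⁻¹ m p in pure k i , v
  locate (inj₂ m) (inj₂ j)           = new-corner m (inj₂ j)

  locate-old : ∀ k x e → locate (inj₁ x) (inj₁ (k , at k x e)) ≡ old-vertex k e (find e) refl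
  locate-old k x e = cong (λ e → old-vertex k e (find e) refl) (at-slope k x e)

  old-vertex-regular : ∀ k e m (eq : find e ≡ m) (eq′ : find e ≡ nothing) →
                       old-vertex k e m eq ≡ (regular e eq′ , k)
  old-vertex-regular k e nothing  eq eq′ = refl
  old-vertex-regular k e (just _) eq eq′ = contradiction (trans (sym eq) eq′) λ()

  located : ∀ k j a → locate k (pt k j a) ≡ (j , a)
  located (inj₁ x) (regular e eq) k = trans
    (locate-old k x e) (old-vertex-regular k e (find e) refl (find-regular eq))
  -- By its form `q` is at least 10, so `find` computes on the residues of 0, 2, 3 and 5.
  located (inj₁ x) (broken 0F) 0F = locate-old 0F x [ + 0 ]
  located (inj₁ x) (broken 0F) 1F = locate-old 1F x [ + 0 ]
  located (inj₁ x) (broken 1F) 0F = locate-old 0F x [ + 5 ]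
  located (inj₁ x) (broken 1F) 1F = locate-old 1F x [ + 5 ]
  located (inj₁ x) (broken 2F) 0F = locate-old 1F x [ + 2 ]
  located (inj₁ x) (broken 2F) 1F = locate-old 2F x [ + 2 ]
  located (inj₁ x) (broken 3F) 0F = locate-old 1F x [ + 3 ]
  located (inj₁ x) (broken 3F) 1F = locate-old 2F x [ + 3 ]
  located (inj₁ x) (broken 4F) 0F = locate-old 0F x [ + 2 ]
  located (inj₁ x) (broken 4F) 1F = locate-old 2F x [ + 0 ]
  located (inj₁ x) (broken 5F) 0F = locate-old 0F x [ + 3 ]
  located (inj₁ x) (broken 5F) 1F = locate-old 2F x [ + 5 ]
  located (inj₁ x) (broken b)  2F = cong [ _ , _ ]′ (Fin.splitAt-↑ˡ 6 b 2)
  located (inj₂ m) (pure k i) v with part m i v | part⁻¹-part m i v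
  ... | _ | p , refl , eq = cong (λ (i , v) → pure k i , v) eq
  located (inj₂ m) (spec a) v with special m a v in eq
  ... | inj₁ k = cong (λ (a , b) → spec a , b) (trans (cong (seek m) (sym eq)) (sought m a v))
  ... | inj₂ j = cong (λ (a , b) → spec a , b) (trans (cong (seek m) (sym eq)) (sought m a v))

  -- For A, C pairs class-of misses the class of the broken triples 4 and 5 by one.
  shift : Fin 3 → Fin 3 → Z → Maybe (Fin 4) → Z
  shift k  l  x nothing   = x
  shift 0F 2F x (just 2F) = x - [ + 1 ]
  shift 0F 2F x (just 3F) = x + [ + 1 ]
  shift 2F 0F x (just 2F) = x - [ + 1 ]
  shift 2F 0F x (just 3F) = x + [ + 1 ]
  shift _  _  x (just _)  = x

  colour-inf : Fin 3 → Z → Fin 2 → Maybe ℕ → Class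
  colour-inf k p m nothing  = inj₂ m
  colour-inf k p m (just c) = inj₁ (class-at k [ + c ] p)

  colour : Point → Point → Class
  colour (inj₁ (k , p)) (inj₁ (l , p′)) =
    if does (k Fin.≟ l) then inj₂ (pure-hue p p′) else
    let x = class-of k l p p′ in inj₁ (shift k l x (find (p - slope k * x)))
  -- Where the offset is `nothing`, only the point 0 of group `k` can share a triple with `j`, so
  -- the hue may be read off the corner without looking at `p`.
  colour (inj₁ (k , p)) (inj₂ j) = colour-inf k p (hue (inj₁ k) (inj₂ j)) (offset k j)
  colour (inj₂ j) (inj₁ (k , p)) = colour-inf k p (hue (inj₂ j) (inj₁ k)) (offset k j)
  colour (inj₂ i) (inj₂ j)       = inj₂ (hue (inj₂ i) (inj₂ j))

  colour-at : ∀ {k l} → k ≢ l → ∀ x e →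
              colour (inj₁ (k , at k x e)) (inj₁ (l , at l x e)) ≡ inj₁ (shift k l x (find e))
  colour-at {k} {l} k≢l x e with k Fin.≟ l
  ... | yes k≡l = contradiction k≡l k≢l
  ... | no _    = cong inj₁ (trans
    (cong (λ x′ → shift k l x′ (find (at k x e - slope k * x′))) (class-of-at k≢l x e))
    (cong (shift k l x ∘ find) (at-slope k x e)))

  colour-inf-at : ∀ k m x c → colour-inf k (at k x [ + c ]) m (just c) ≡ inj₁ x
  colour-inf-at k m x c = cong inj₁ (class-at-at k x [ + c ])

  colour-pure : ∀ k p p′ → colour (inj₁ (k , p)) (inj₁ (k , p′)) ≡ inj₂ (pure-hue p p′)
  colour-pure k p p′ with k Fin.≟ k
  ... | yes _  = refl
  ... | no k≢k = contradiction refl k≢k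

  colour-spec : ∀ m a {b c} → b ≢ c → colour (corner (special m a b)) (corner (special m a c)) ≡ inj₂ m
  colour-spec m a {b} {c} b≢c with special m a b in eq | special m a c in eq′ | hued m a b c b≢c
  ... | inj₁ k | w | h with free m a b c b≢c k eq
  ...   | j , eq″ , off with refl ← trans (sym eq′) eq″ rewrite off = cong inj₂ h
  colour-spec m a {b} {c} b≢c | inj₂ i | inj₂ j | h = cong inj₂ h
  colour-spec m a {b} {c} b≢c | inj₂ i | inj₁ k | h with free m a c b (b≢c ∘ sym) k eq′
  ...   | j , eq″ , off with refl ← trans (sym eq) eq″ rewrite off = cong inj₂ h

  offset-base : ∀ b v → let k , c = broken-base b v in offset k (b ↑ˡ 2) ≡ just c
  offset-base 0F 0F = refl
  offset-base 0F 1F = refl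
  offset-base 1F 0F = refl
  offset-base 1F 1F = refl
  offset-base 2F 0F = refl
  offset-base 2F 1F = refl
  offset-base 3F 0F = refl
  offset-base 3F 1F = refl
  offset-base 4F 0F = refl
  offset-base 4F 1F = refl
  offset-base 5F 0F = refl
  offset-base 5F 1F = refl

  colour-broken-inf : ∀ b v m x → let k , p = base-point b v x in
                      colour-inf k p m (offset k (b ↑ˡ 2)) ≡ inj₁ x
  colour-broken-inf b v m x = let k , c = broken-base b v in
    trans (cong (colour-inf k (at k x [ + c ]) m) (offset-base b v)) (colour-inf-at k m x c)

  private
    -- The pair is rewritten as two vertices of the net triple `e` of class `y`, which is what
    -- `class-of` detects; `shift` then leads from `y` to `x`.
    colour-moved : ∀ {k l} x y c d e → k ≢ l → at k x [ + c ] ≡ at k y e → at l x [ + d ] ≡ at l y e →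
                   shift k l y (find e) ≡ x →
                   colour (inj₁ (k , at k x [ + c ])) (inj₁ (l , at l x [ + d ])) ≡ inj₁ x
    colour-moved {k} {l} x y c d e k≢l p q r = trans
      (cong₂ (λ p p′ → colour (inj₁ (k , p)) (inj₁ (l , p′))) p q) (trans (colour-at k≢l y e) (cong inj₁ r))

    A₄ : ∀ x → at 0F x [ + 2 ] ≡ at 0F (x - [ + 1 ]) [ + 3 ]
    A₄ = solve 1 (λ x → con (+ 1) :* x :+ con (+ 2) := con (+ 1) :* (x :- con (+ 1)) :+ con (+ 3)) refl

    C₄ : ∀ x → at 2F x [ + 0 ] ≡ at 2F (x - [ + 1 ]) [ + 3 ]
    C₄ = solve 1 (λ x → con (+ 3) :* x :+ con (+ 0) := con (+ 3) :* (x :- con (+ 1)) :+ con (+ 3)) refl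

    A₅ : ∀ x → at 0F x [ + 3 ] ≡ at 0F (x + [ + 1 ]) [ + 2 ]
    A₅ = solve 1 (λ x → con (+ 1) :* x :+ con (+ 3) := con (+ 1) :* (x :+ con (+ 1)) :+ con (+ 2)) refl

    C₅ : ∀ x → at 2F x [ + 5 ] ≡ at 2F (x + [ + 1 ]) [ + 2 ]
    C₅ = solve 1 (λ x → con (+ 3) :* x :+ con (+ 5) := con (+ 3) :* (x :+ con (+ 1)) :+ con (+ 2)) refl

    back₄ : ∀ x → x - [ + 1 ] + [ + 1 ] ≡ x
    back₄ = solve 1 (λ x → x :- con (+ 1) :+ con (+ 1) := x) refl

    back₅ : ∀ x → x + [ + 1 ] - [ + 1 ] ≡ x
    back₅ = solve 1 (λ x → x :+ con (+ 1) :- con (+ 1) := x) refl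

  colour-broken : ∀ b x → colour (inj₁ (base-point b 0F x)) (inj₁ (base-point b 1F x)) ≡ inj₁ x
                        × colour (inj₁ (base-point b 1F x)) (inj₁ (base-point b 0F x)) ≡ inj₁ x
  colour-broken 0F x = colour-at {0F} {1F} (λ ()) x [ + 0 ] , colour-at {1F} {0F} (λ ()) x [ + 0 ]
  colour-broken 1F x = colour-at {0F} {1F} (λ ()) x [ + 5 ] , colour-at {1F} {0F} (λ ()) x [ + 5 ]
  colour-broken 2F x = colour-at {1F} {2F} (λ ()) x [ + 2 ] , colour-at {2F} {1F} (λ ()) x [ + 2 ]
  colour-broken 3F x = colour-at {1F} {2F} (λ ()) x [ + 3 ] , colour-at {2F} {1F} (λ ()) x [ + 3 ]
  colour-broken 4F x = colour-moved {0F} {2F} x (x - [ + 1 ]) 2 0 [ + 3 ] (λ ()) (A₄ x) (C₄ x) (back₄ x)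
                     , colour-moved {2F} {0F} x (x - [ + 1 ]) 0 2 [ + 3 ] (λ ()) (C₄ x) (A₄ x) (back₄ x)
  colour-broken 5F x = colour-moved {0F} {2F} x (x + [ + 1 ]) 3 5 [ + 2 ] (λ ()) (A₅ x) (C₅ x) (back₅ x)
                     , colour-moved {2F} {0F} x (x + [ + 1 ]) 5 3 [ + 2 ] (λ ()) (C₅ x) (A₅ x) (back₅ x)

  coloured : ∀ k j {a b} → a ≢ b → colour (pt k j a) (pt k j b) ≡ k
  coloured (inj₁ x) (regular e eq) {k} {l} k≢l =
    trans (colour-at k≢l x e) (cong (inj₁ ∘ shift k l x) (find-regular eq))
  coloured (inj₁ x) (broken b) {0F} {1F} _ = proj₁ (colour-broken b x)
  coloured (inj₁ x) (broken b) {1F} {0F} _ = proj₂ (colour-broken b x)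
  coloured (inj₁ x) (broken b) {0F} {2F} _ = colour-broken-inf b 0F _ x
  coloured (inj₁ x) (broken b) {1F} {2F} _ = colour-broken-inf b 1F _ x
  coloured (inj₁ x) (broken b) {2F} {0F} _ = colour-broken-inf b 0F _ x
  coloured (inj₁ x) (broken b) {2F} {1F} _ = colour-broken-inf b 1F _ x
  coloured (inj₁ x) (broken b) {0F} {0F} a≢b = contradiction refl a≢b
  coloured (inj₁ x) (broken b) {1F} {1F} a≢b = contradiction refl a≢b
  coloured (inj₁ x) (broken b) {2F} {2F} a≢b = contradiction refl a≢b
  coloured (inj₂ m) (pure k i) {v} {w} v≢w =
    trans (colour-pure k (part m i v) (part m i w)) (cong inj₂ (pure-hue-part (ℕ.m≤m+n 3 s′) m i v≢w))
  coloured (inj₂ m) (spec a) b≢c = colour-spec m a b≢c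

  design : Design Class Triple Point
  design = certified pt locate located colour coloured

  -- Cutting down to g new classes

  module Capped (g : ℕ) (1≤g : 1 ≤ g) (g≤2 : g ≤ 2)
    (bounded : Bounded g g≤2) (rainbowed : Rainbowed g g≤2)
    where

    c : ℕ
    c = 2 ℕ.+ 3 ℕ.* g

    c≤8 : c ≤ 8
    c≤8 = ℕ.+-monoʳ-≤ 2 (ℕ.*-monoʳ-≤ 3 g≤2)

    -- An old class keeps `4 + g` broken triples, each with its own infinite point; these have to be
    -- among the `c` points kept.
    4+g≤c : 4 ℕ.+ g ≤ c
    4+g≤c = ℕ.+-monoʳ-≤ 2 (ℕ.≤-trans (ℕ.+-monoˡ-≤ g (ℕ.+-mono-≤ 1≤g 1≤g)) (ℕ.≤-reflexive
      (trans (ℕ.+-assoc g g g) (cong (λ z → g ℕ.+ (g ℕ.+ z)) (sym (ℕ.+-identityʳ g))))))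

    class : Fin (q ℕ.+ g) → Class
    class = Sum.map₂ (λ m → inject≤ m g≤2) ∘ splitAt q

    class-injective : ∀ {k l} → class k ≡ class l → k ≡ l
    class-injective {k} {l} eq = trans (sym (Fin.join-splitAt q g k))
      (trans (cong (join q g) (map₂-inj (splitAt q k) (splitAt q l) eq)) (Fin.join-splitAt q g l))
      where
      map₂-inj : ∀ (x y : Z ⊎ Fin g) →
                 Sum.map₂ (λ m → inject≤ m g≤2) x ≡ Sum.map₂ (λ m → inject≤ m g≤2) y → x ≡ y
      map₂-inj (inj₁ x) (inj₁ y) eq = cong inj₁ (Sum.inj₁-injective eq)
      map₂-inj (inj₂ x) (inj₂ y) eq = cong inj₂ (Fin.inject≤-injective g≤2 g≤2 x y (Sum.inj₂-injective eq))

    old-at : (e : Z) (m : Maybe (Fin 4)) → .(find e ≡ m) → Old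
    old-at e nothing  eq = regular e eq
    old-at e (just i) _  = broken (i ↑ˡ 2)

    -- The four broken-up numbers now index the broken triples 0 to 3; the `g` additional indices
    -- stand for the broken triples 4 and 5, as far as they are kept.
    old : Z ⊎ Fin g → Old
    old (inj₁ e) = old-at e (find e) refl
    old (inj₂ m) = broken (4 ↑ʳ inject≤ m g≤2)

    old⁻¹ : Old → Z ⊎ Fin 2
    old⁻¹ (regular e _) = inj₁ e
    old⁻¹ (broken 0F)   = inj₁ [ + 0 ]
    old⁻¹ (broken 1F)   = inj₁ [ + 5 ]
    old⁻¹ (broken 2F)   = inj₁ [ + 2 ]
    old⁻¹ (broken 3F)   = inj₁ [ + 3 ]
    old⁻¹ (broken 4F)   = inj₂ 0F
    old⁻¹ (broken 5F)   = inj₂ 1F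

    old⁻¹-broken : ∀ e i → find e ≡ just i → old⁻¹ (broken (i ↑ˡ 2)) ≡ inj₁ e
    old⁻¹-broken zero                               .0F refl = refl
    old⁻¹-broken (suc (suc zero))                   .2F refl = refl
    old⁻¹-broken (suc (suc (suc zero)))             .3F refl = refl
    old⁻¹-broken (suc (suc (suc (suc (suc zero))))) .1F refl = refl

    old⁻¹-old : ∀ x → old⁻¹ (old x) ≡ Sum.map₂ (λ m → inject≤ m g≤2) x
    old⁻¹-old (inj₁ e) = lemma (find e) refl
      where
      lemma : ∀ m (eq : find e ≡ m) → old⁻¹ (old-at e m eq) ≡ inj₁ e
      lemma nothing  eq = refl
      lemma (just i) eq = old⁻¹-broken e i eq
    old⁻¹-old (inj₂ m) with inject≤ m g≤2
    ... | 0F = refl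
    ... | 1F = refl

    -- As q = 3s + 1, the 3s triples inside the groups and the g + 1 special ones fill a new class.
    size : q ℕ.+ g ≡ s ℕ.* 3 ℕ.+ suc g
    size = sym (ℕ.+-suc (s ℕ.* 3) g)

    new : Fin (s ℕ.* 3) ⊎ Fin (suc g) → New
    new (inj₁ p) = let i , k = remQuot 3 p in pure k i
    new (inj₂ a) = spec (inject≤ a (s≤s g≤2))

    new-injective : ∀ {x y} → new x ≡ new y → x ≡ y
    new-injective {inj₁ p} {inj₁ p′} eq = cong inj₁ (trans (sym (Fin.combine-remQuot {s} 3 p))
      (trans (lemma eq) (Fin.combine-remQuot {s} 3 p′)))
      where
      lemma : ∀ {k k′ i i′} → New.pure k i ≡ pure k′ i′ → combine i k ≡ combine i′ k′
      lemma refl = refl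
    new-injective {inj₂ a} {inj₂ a′} eq = cong inj₂
      (Fin.inject≤-injective (s≤s g≤2) (s≤s g≤2) a a′ (lemma eq))
      where
      lemma : ∀ {a a′} → New.spec a ≡ spec a′ → a ≡ a′
      lemma refl = refl

    triple : ∀ k → Fin (q ℕ.+ g) → Triple k
    triple (inj₁ x) = old ∘ splitAt q
    triple (inj₂ m) = new ∘ splitAt (s ℕ.* 3) ∘ cast size

    triple-injective : ∀ k {i j} → triple k i ≡ triple k j → i ≡ j
    triple-injective (inj₁ x) {i} {j} eq = class-injective
      (trans (sym (old⁻¹-old (splitAt q i))) (trans (cong old⁻¹ eq) (old⁻¹-old (splitAt q j))))
    triple-injective (inj₂ m) {i} {j} eq = Fin.toℕ-injective (trans (sym (Fin.toℕ-cast size i))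
      (trans (cong toℕ (trans (sym (Fin.join-splitAt (s ℕ.* 3) (suc g) (cast size i)))
        (trans (cong (join (s ℕ.* 3) (suc g)) (new-injective eq))
          (Fin.join-splitAt (s ℕ.* 3) (suc g) (cast size j)))))
      (Fin.toℕ-cast size j)))

    Small : Point → Set
    Small (inj₁ _) = ⊤
    Small (inj₂ j) = toℕ j < c

    shrink : Point → (Fin 3 × Z) ⊎ Fin c
    shrink (inj₁ p) = inj₁ p
    shrink (inj₂ j) with toℕ j ℕ.<? c
    ... | yes j<c = inj₂ (fromℕ< j<c)
    -- A filler: by `small` no vertex of a kept triple gets here.
    ... | no  _   = inj₂ zero

    grow : (Fin 3 × Z) ⊎ Fin c → Point
    grow = Sum.map₂ (λ j → inject≤ j c≤8)

    grow-shrink : ∀ p → Small p → grow (shrink p) ≡ p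
    grow-shrink (inj₁ p) _ = refl
    grow-shrink (inj₂ j) small with toℕ j ℕ.<? c
    ... | yes j<c = cong inj₂ (Fin.toℕ-injective (trans (Fin.toℕ-inject≤ (fromℕ< j<c) c≤8) (Fin.toℕ-fromℕ< j<c)))
    ... | no  j≮c = contradiction small j≮c

    small-broken : ∀ x b a → toℕ b < c → Small (pt (inj₁ x) (broken b) a)
    small-broken x b 0F _ = tt
    small-broken x b 1F _ = tt
    small-broken x b 2F b<c = subst (_< c) (sym (Fin.toℕ-↑ˡ b 2)) b<c

    small-old : ∀ x y a → Small (pt (inj₁ x) (old y) a)
    small-old x (inj₁ e) a = lemma (find e) refl
      where
      lemma : ∀ m (eq : find e ≡ m) → Small (pt (inj₁ x) (old-at e m eq) a)
      lemma nothing  _ = tt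
      lemma (just i) _ = small-broken x (i ↑ˡ 2) a (ℕ.<-≤-trans
        (subst (_< 4) (sym (Fin.toℕ-↑ˡ i 2)) (Fin.toℕ<n i))
        (ℕ.≤-trans (ℕ.m≤m+n 4 g) 4+g≤c))
    small-old x (inj₂ m) a = small-broken x (4 ↑ʳ inject≤ m g≤2) a (ℕ.<-≤-trans
      (subst (_< 4 ℕ.+ g) (sym (trans (Fin.toℕ-↑ʳ 4 (inject≤ m g≤2)) (cong (4 ℕ.+_) (Fin.toℕ-inject≤ m g≤2))))
        (ℕ.+-monoʳ-< 4 (Fin.toℕ<n m))) 4+g≤c)

    small-new : ∀ (m : Fin g) y b → Small (pt (inj₂ (inject≤ m g≤2)) (new y) b)
    small-new m (inj₁ p) b = tt
    small-new m (inj₂ a) b with special (inject≤ m g≤2) (inject≤ a (s≤s g≤2)) b in eq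
    ... | inj₁ k = tt
    ... | inj₂ j = bounded m a b j eq

    small : ∀ k j a → Small (pt (class k) (triple (class k) j) a)
    small k j a = lemma (splitAt q k)
      where
      lemma : ∀ x → let k = Sum.map₂ (λ m → inject≤ m g≤2) x in Small (pt k (triple k j) a)
      lemma (inj₁ x) = small-old x (splitAt q j) a
      lemma (inj₂ m) = small-new m (splitAt (s ℕ.* 3) (cast size j)) a

    T : ∀ k → Triple k
    -- The number 4 is not among 0, 5, 2, 3, so this net triple is intact in every old class.
    T (inj₁ x) = regular 4F refl
    T (inj₂ m) = spec 0F

    T-index : Class → Fin (q ℕ.+ g)
    T-index (inj₁ x) = 4F ↑ˡ g
    T-index (inj₂ m) = cast (sym size) (s ℕ.* 3 ↑ʳ 0F)

    triple-T : ∀ k → triple k (T-index k) ≡ T k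
    triple-T (inj₁ x) = cong old (Fin.splitAt-↑ˡ q 4F g)
    triple-T (inj₂ m) = trans
      (cong (new ∘ splitAt (s ℕ.* 3)) (Fin.cast-involutive size (sym size) (s ℕ.* 3 ↑ʳ 0F)))
      (cong new (Fin.splitAt-↑ʳ (s ℕ.* 3) (suc g) 0F))

    rainbow-colour : Point → Class
    rainbow-colour (inj₁ (k , p)) = inj₁ (class-at k 4F p)
    rainbow-colour (inj₂ j)       = inj₂ (rainbow-hue (inj₂ j))

    rainbow-coloured : ∀ k a → rainbow-colour (pt (class k) (T (class k)) a) ≡ class k
    rainbow-coloured k a = lemma (splitAt q k)
      where
      lemma : ∀ x → let k = Sum.map₂ (λ m → inject≤ m g≤2) x in rainbow-colour (pt k (T k) a) ≡ k
      lemma (inj₁ x) = cong inj₁ (class-at-at a x 4F)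
      lemma (inj₂ m) = let j , eq , hue≡ = rainbowed m a in
        trans (cong (rainbow-colour ∘ corner) eq) (cong inj₂ hue≡)

    R : Restriction design
    R = record
      { pt′        = λ k j a → encode {q} {c} (shrink (pt (class k) (triple (class k) j) a))
      ; class      = class
      ; triple     = λ k → triple (class k)
      ; point      = grow ∘ decode {q} {c}
      ; class-inj  = class-injective
      ; triple-inj = λ k → triple-injective (class k)
      ; point-pt′  = λ k j a → trans
          (cong grow (decode-encode {q} {c} (shrink (pt (class k) (triple (class k) j) a))))
          (grow-shrink _ (small k j a))
      }

    rainbow-design : RainbowDesign (q ℕ.+ g) (3 ℕ.* q ℕ.+ c)
    rainbow-design = restrict design R , restrict-rainbow design R T (T-index ∘ class) (triple-T ∘ class)
      λ {k} {k′} {a} {a′} eq → trans (sym (rainbow-coloured k a))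
        (trans (cong rainbow-colour eq) (rainbow-coloured k′ a′))

-- For g = 1 only the triples 0 and 1 of class 0 survive; the others are fillers.
special₁ : Fin 2 → Fin 3 → Fin 3 → Corner
special₁ 0F 0F 0F = inj₂ 0F
special₁ 0F 0F 1F = inj₂ 1F
special₁ 0F 0F 2F = inj₂ 4F
special₁ 0F 1F 0F = inj₁ 0F
special₁ 0F 1F 1F = inj₂ 2F
special₁ 0F 1F 2F = inj₂ 3F
special₁ 0F 2F 0F = inj₁ 1F
special₁ 0F 2F 1F = inj₂ 5F
special₁ 0F 2F 2F = inj₂ 6F
special₁ 1F 0F 0F = inj₂ 0F
special₁ 1F 0F 1F = inj₂ 2F
special₁ 1F 0F 2F = inj₂ 5F
special₁ 1F 1F 0F = inj₁ 1F
special₁ 1F 1F 1F = inj₂ 4F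
special₁ 1F 1F 2F = inj₂ 7F
special₁ 1F 2F 0F = inj₁ 2F
special₁ 1F 2F 1F = inj₂ 1F
special₁ 1F 2F 2F = inj₂ 6F

-- The first triples of the two classes are disjoint, as the rainbow requires. The infinite points 6
-- and 7 are on no broken triple, so every corner may meet them.
special₂ : Fin 2 → Fin 3 → Fin 3 → Corner
special₂ 0F 0F 0F = inj₂ 0F
special₂ 0F 0F 1F = inj₂ 2F
special₂ 0F 0F 2F = inj₂ 4F
special₂ 0F 1F 0F = inj₁ 2F
special₂ 0F 1F 1F = inj₂ 1F
special₂ 0F 1F 2F = inj₂ 6F
special₂ 0F 2F 0F = inj₁ 0F
special₂ 0F 2F 1F = inj₂ 3F
special₂ 0F 2F 2F = inj₂ 7F
special₂ 1F 0F 0F = inj₂ 1F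
special₂ 1F 0F 1F = inj₂ 3F
special₂ 1F 0F 2F = inj₂ 5F
special₂ 1F 1F 0F = inj₁ 0F
special₂ 1F 1F 1F = inj₂ 2F
special₂ 1F 1F 2F = inj₂ 6F
special₂ 1F 2F 0F = inj₁ 1F
special₂ 1F 2F 1F = inj₂ 4F
special₂ 1F 2F 2F = inj₂ 7F

-- Assembly over the residues modulo 6

open import Data.Nat using (_+_; _*_; _∸_)
open ℤmod using (inverses)
open ℕ.+-*-Solver

points : ∀ q g → 3 * q + (2 + 3 * g) ≡ 3 * suc (q + g) ∸ 1
-- The right-hand side is what `3 * suc (q + g) ∸ 1` computes to.
points = solve 2 (λ q g → con 3 :* q :+ (con 2 :+ con 3 :* g) :=
  (q :+ g) :+ ((con 1 :+ (q :+ g)) :+ ((con 1 :+ (q :+ g)) :+ con 0))) refl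

-- The moduli 6r + 1, for the residues 0 (punctured) and 1 (full) of m.
module Net₁ (r : ℕ) = NetDesigns (r * 6) _ _
  (inverses (r * 6) 2 (3 * r + 1) 1 (solve 1 (λ r →
    con 2 :* (con 3 :* r :+ con 1) := con 1 :+ con 1 :* (con 1 :+ r :* con 6)) refl r))
  (inverses (r * 6) 3 (4 * r + 1) 2 (solve 1 (λ r →
    con 3 :* (con 4 :* r :+ con 1) := con 1 :+ con 2 :* (con 1 :+ r :* con 6)) refl r))

-- The moduli 6r + 5, for the residues 4 (punctured) and 5 (full) of m.
module Net₅ (r : ℕ) = NetDesigns (4 + r * 6) _ _
  (inverses (4 + r * 6) 2 (3 * r + 3) 1 (solve 1 (λ r →
    con 2 :* (con 3 :* r :+ con 3) := con 1 :+ con 1 :* (con 5 :+ r :* con 6)) refl r))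
  (inverses (4 + r * 6) 3 (2 * r + 2) 1 (solve 1 (λ r →
    con 3 :* (con 2 :* r :+ con 2) := con 1 :+ con 1 :* (con 5 :+ r :* con 6)) refl r))

-- An even s = 4 + 2r makes q = 3s + 1 = 6r + 13 odd, so that 2 is a unit.
grown : ∀ r special {g} (g≤2 : g ≤ 2) → 1 ≤ g → let open Cap special in
  Hued → Sought → Free → Bounded g g≤2 → Rainbowed g g≤2 →
  ∀ {m} → suc ((4 + 2 * r) * 3) + g ≡ m → RainbowDesign m (3 * suc m ∸ 1)
grown r special {g} g≤2 1≤g hued sought free bounded rainbowed eq =
  subst₂ RainbowDesign eq (trans (points (suc ((4 + 2 * r) * 3)) g) (cong (λ m → 3 * suc m ∸ 1) eq))
    (Growth.Capped.rainbow-design (1 + 2 * r) _ _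
      (inverses ((4 + 2 * r) * 3) 2 (7 + 3 * r) 1 (solve 1 (λ r →
        con 2 :* (con 7 :+ con 3 :* r) := con 1 :+ con 1 :* (con 1 :+ (con 4 :+ con 2 :* r) :* con 3)) refl r))
      (inverses ((4 + 2 * r) * 3) 3 (9 + 4 * r) 2 (solve 1 (λ r →
        con 3 :* (con 9 :+ con 4 :* r) := con 1 :+ con 2 :* (con 1 :+ (con 4 :+ con 2 :* r) :* con 3)) refl r))
      special hued sought free g 1≤g g≤2 bounded rainbowed)

rainbow-design : ∀ (i : Fin 6) r → let m = toℕ i + r * 6 in 3 ≤ m → RainbowDesign m (3 * suc m ∸ 1)
rainbow-design 0F r _ = Net₁.punctured r
rainbow-design 1F r _ = subst (RainbowDesign (1 + r * 6))
  (trans (points (1 + r * 6) 0) (cong (λ m → 3 * suc m ∸ 1) (ℕ.+-identityʳ (1 + r * 6)))) (Net₁.full r)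
rainbow-design 2F 0 (s≤s (s≤s ()))
rainbow-design 2F 1 _ = design₈
rainbow-design 2F (suc (suc r)) _ = grown r special₁ {1} (s≤s z≤n) (s≤s z≤n)
  (toWitness {a? = Cap.hued? special₁} _) (toWitness {a? = Cap.sought? special₁} _)
  (toWitness {a? = Cap.free? special₁} _) (toWitness {a? = Cap.bounded? special₁ 1 (s≤s z≤n)} _)
  (toWitness {a? = Cap.rainbowed? special₁ 1 (s≤s z≤n)} _)
  (solve 1 (λ r → con 1 :+ (con 4 :+ con 2 :* r) :* con 3 :+ con 1 := con 2 :+ (con 2 :+ r) :* con 6) refl r)
rainbow-design 3F 0 _ = design₃
rainbow-design 3F 1 _ = design₉
rainbow-design 3F (suc (suc r)) _ = grown r special₂ {2} (s≤s (s≤s z≤n)) (s≤s z≤n)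
  (toWitness {a? = Cap.hued? special₂} _) (toWitness {a? = Cap.sought? special₂} _)
  (toWitness {a? = Cap.free? special₂} _) (toWitness {a? = Cap.bounded? special₂ 2 (s≤s (s≤s z≤n))} _)
  (toWitness {a? = Cap.rainbowed? special₂ 2 (s≤s (s≤s z≤n))} _)
  (solve 1 (λ r → con 1 :+ (con 4 :+ con 2 :* r) :* con 3 :+ con 2 := con 3 :+ (con 2 :+ r) :* con 6) refl r)
rainbow-design 4F r _ = Net₅.punctured r
rainbow-design 5F r _ = subst (RainbowDesign (5 + r * 6))
  (trans (points (5 + r * 6) 0) (cong (λ m → 3 * suc m ∸ 1) (ℕ.+-identityʳ (5 + r * 6)))) (Net₅.full r)

theorem2p8 : ∀ (n ρ : ℕ) → 4 ≤ n → n ≢ 6 → 1 ≤ ρ → ρ ≤ n ∸ 1 →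
    Σ[ 𝓟 ∈ Packing (3 * n ∸ 1 + ρ) 4 ]
    length (blocks 𝓟) ≡ (n ∸ 1) * ρ + D ρ 4
    × LargestPPC 𝓟 ρ
theorem2p8 (suc m) ρ (s≤s 3≤m) _ _ ρ≤m with m divMod 6
... | result r i refl =
  let 𝒟 , 𝓡 = rainbow-design i r 3≤m
      -- The first two summands of `m + (suc m + (suc m + 0))` are at least 3 and 1.
      4≤ = ℕ.≤-trans (ℕ.≤-trans (ℕ.+-mono-≤ 3≤m (s≤s z≤n)) (ℕ.+-monoʳ-≤ m (ℕ.m≤m+n (suc m) (suc m + 0)))) (ℕ.m≤m+n _ ρ)
  in packing 𝒟 𝓡 ρ≤m 4≤ , length-packing 𝒟 𝓡 ρ≤m 4≤ , largestPPC 𝒟 𝓡 ρ≤m 4≤
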